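{- Let $T=\overline{T}_{i,j,m}$ be the almost representative hat with vertices $A=(0,0)$, $B=(i,j)$, $C=(m,0)$, and let $T'=\overline{T}_{k,l,n}$ be the almost representative hat with vertices $(0,0)$, $(k,l)$, $(n,0)$, where $i,k$ are arbitrary integers and $j,m,l,n$ are positive odd integers. Assume that $T$ and $T'$ have equal or oppositely oriented boundary types and that the areas of their convex $\mathbb{R}$-hulls are equal. Let $\iota$ be a bijection from the vertex set of $T$ onto the vertex set of $T'$, and write $A'=\iota(A)$, $B'=\iota(B)$, $C'=\iota(C)$. Say that $\iota$ \emph{is an isomorphism} if it is the restriction to vertices of a (groupoid) isomorphism $T\to T'$. Write $\iota: ABC\to XYZ$, where $XYZ$ is a permutation of $A',B',C'$, to mean that $X=(0,0)$, $Y=(k,l)$ and $Z=(n,0)$. Then $\iota$ is of one of the following six kinds, and in each case the stated criterion holds. (a) If $\iota: ABC\to A'B'C'$, then $\iota$ is an isomorphism precisely when $l=j$, $n=m$ and $k=i+jp$ for some integer $p$. (b) If $\iota: ABC\to C'B'A'$, then $\iota$ is an isomorphism precisely when $l=j$, $n=m$ and $k=m-i+jp$ for some integer $p$. (c) If $\iota: ABC\to A'C'B'$, then $\iota$ is an isomorphism precisely when $n=\gcd\{i,j\}$, $l=mj/n$ and $k=am$ for some integer $a$ that is a solution of $ai\equiv n\pmod{j}$. (d) If $\iota: ABC\to C'A'B'$, then $\iota$ is an isomorphism precisely when $n=\gcd\{m-i,j\}$, $l=mj/n$ and $k=am$ for some integer $a$ that is a solution of $a(m-i)\equiv n\pmod{j}$.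 (e) If $\iota: ABC\to B'C'A'$, then $\iota$ is an isomorphism precisely when $n=\gcd\{i,j\}$, $l=mj/n$ and $k=n-am$ for some integer $a$ that is a solution of $ai\equiv n\pmod{j}$. (f) If $\iota: ABC\to B'A'C'$, then $\iota$ is an isomorphism precisely when $n=\gcd\{m-i,j\}$, $l=mj/n$ and $k=n-am$ for some integer $a$ that is a solution of $a(m-i)\equiv n\pmod{j}$.
   Context: $\mathbb{D}=\mathbb{Z}[1/2]$ is the ring of dyadic rationals. A dyadic triangle is the intersection with $\mathbb{D}^2$ of a nondegenerate real triangle whose vertices lie in $\mathbb{D}^2$; the real triangle is its convex $\mathbb{R}$-hull. It is regarded as a groupoid under $x\circ y=\frac12(x+y)$. Isomorphisms are bijections preserving $\circ$; equivalently, they are restrictions of automorphisms of the affine $\mathbb{D}$-space $\mathbb{D}^2$, that is, of maps $x\mapsto xM+v$ with $M\in \mathrm{GL}(2,\mathbb{D})$, $v\in\mathbb{D}^2$. For an integer $i$ and positive odd integers $j,m$, the almost representative hat $\overline{T}_{i,j,m}$ is the dyadic triangle with vertices $(0,0),(i,j),(m,0)$. Every nontrivial dyadic interval (the set of points of $\mathbb{D}^2$ on a segment with distinct endpoints in $\mathbb{D}^2$) is isomorphic, under $\circ$, to $[0,q]\cap\mathbb{D}$ for a unique positive odd integer $q$, called its type. A dyadic triangle with vertices $P,Q,R$ ordered clockwise has boundary type equal to the triple of types of its sides $(PQ,QR,RP)$, considered up to cyclic order; two boundary types are oppositely oriented if one is obtained from the other by reversing the cyclic order. -}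

module Defs where

open import Algebra.Bundles using (CommutativeRing; RawMagma)
open import Algebra.Core using (Op₂)
open import Algebra.Morphism.Structures using (module MagmaMorphisms)
open import Data.Fin.Base using (Fin)
open import Data.Fin.Patterns using (0F; 1F; 2F)
open import Data.Fin.Permutation using (Permutation′; _⟨$⟩ʳ_)
open import Data.Integer.Base as ℤ using (ℤ; +_; 0ℤ)
import Data.Integer.Properties as ℤₚ
open import Data.Nat.Base as ℕ using (ℕ; suc)
import Data.Nat.Divisibility as ℕ
import Data.Nat.Properties as ℕₚ
open import Data.Product.Base using (Σ; ∃; ∃₂; _×_; _,_; proj₁; proj₂)
open import Data.Rational.Base
open import Data.Rational.Properties
import Data.Rational.Unnormalised.Base as ℚᵘ
import Data.Rational.Unnormalised.Properties as ℚᵘₚ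
open import Data.Rational.Solver using (module +-*-Solver)
open import Data.Sum.Base using (_⊎_)
open import Data.Vec.Functional using (Vector; []; _∷_)
open import Function.Base using (_on_; _∘_)
open import Function.Bundles using (Bijection)
open import Level using (0ℓ)
open import Relation.Binary.Bundles using (Setoid)
import Relation.Binary.Construct.On as On
open import Relation.Binary.PropositionalEquality
open import Relation.Nullary.Negation using (¬_)
open import Relation.Unary using (Pred)

open import Algebra.Properties.Semiring.Sum
  (CommutativeRing.semiring +-*-commutativeRing)
  using (sum; ∑-distrib-+; *-distribˡ-sum; sum-cong-≗)

open +-*-Solver using (solve; _:=_; _:+_; _:*_; :-_; con)

Odd : ℕ → Set
Odd n = ¬ (2 ℕ.∣ n)

-- 𝔻 = ℤ[1/2], as a subset of ℚ.
Dyadic : Pred ℚ 0ℓ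
Dyadic q = ∃₂ λ (a : ℤ) (e : ℕ) → q ≡ _/_ a (2 ℕ.^ e) {{ℕₚ.m^n≢0 2 e}}

fromℤ : ℤ → ℚ
fromℤ i = i / 1

fromℕ : ℕ → ℚ
fromℕ n = fromℤ (+ n)

fromℤ-dyadic : ∀ i → Dyadic (fromℤ i)
fromℤ-dyadic i = i , 0 , refl

Point : Set
Point = ℚ × ℚ

Dyadic² : Pred Point 0ℓ
Dyadic² (x , y) = Dyadic x × Dyadic y

mean : Op₂ ℚ
mean x y = ½ * (x + y)

midpoint : Op₂ Point
midpoint (x₁ , y₁) (x₂ , y₂) = mean x₁ x₂ , mean y₁ y₂

private
  /-toℚᵘ : ∀ a n .{{_ : ℕ.NonZero n}} → toℚᵘ (a / n) ℚᵘ.≃ (a ℚᵘ./ n)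
  /-toℚᵘ a (suc n) = toℚᵘ-fromℚᵘ (ℚᵘ.mkℚᵘ a n)

  mean-/ : ∀ a m b n .{{_ : ℕ.NonZero m}} .{{_ : ℕ.NonZero n}}
           .{{_ : ℕ.NonZero (2 ℕ.* (m ℕ.* n))}} →
           mean (a / m) (b / n) ≡ (a ℤ.* + n ℤ.+ b ℤ.* + m) / (2 ℕ.* (m ℕ.* n))
  mean-/ a m@(suc _) b n@(suc _) = toℚᵘ-injective (begin
    toℚᵘ (½ * (a / m + b / n))
      ≈⟨ toℚᵘ-homo-* ½ (a / m + b / n) ⟩
    toℚᵘ ½ ℚᵘ.* toℚᵘ (a / m + b / n)
      ≈⟨ ℚᵘₚ.*-congˡ {toℚᵘ ½} (ℚᵘₚ.≃-trans (toℚᵘ-homo-+ (a / m) (b / n))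
           (ℚᵘₚ.+-cong (/-toℚᵘ a m) (/-toℚᵘ b n))) ⟩
    ℚᵘ.½ ℚᵘ.* (a ℚᵘ./ m ℚᵘ.+ b ℚᵘ./ n)
      ≡⟨ cong (λ c → ℚᵘ.mkℚᵘ c _) (ℤₚ.*-identityˡ _) ⟩
    (a ℤ.* + n ℤ.+ b ℤ.* + m) ℚᵘ./ (2 ℕ.* (m ℕ.* n))
      ≈⟨ /-toℚᵘ (a ℤ.* + n ℤ.+ b ℤ.* + m) (2 ℕ.* (m ℕ.* n)) ⟨
    toℚᵘ ((a ℤ.* + n ℤ.+ b ℤ.* + m) / (2 ℕ.* (m ℕ.* n))) ∎)
    where open ℚᵘₚ.≃-Reasoning

mean-dyadic : ∀ {x y} → Dyadic x → Dyadic y → Dyadic (mean x y)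
mean-dyadic (a , e , refl) (b , f , refl) =
  a ℤ.* + (2 ℕ.^ f) ℤ.+ b ℤ.* + (2 ℕ.^ e) , suc (e ℕ.+ f) ,
  trans (mean-/ a (2 ℕ.^ e) b (2 ℕ.^ f)) (/-cong {a ℤ.* + (2 ℕ.^ f) ℤ.+ b ℤ.* + (2 ℕ.^ e)} refl (cong (2 ℕ.*_) (sym (ℕₚ.^-distribˡ-+-* 2 e f))))
  where instance
    _ = ℕₚ.m^n≢0 2 e
    _ = ℕₚ.m^n≢0 2 f
    _ = ℕₚ.m*n≢0 2 (2 ℕ.^ e ℕ.* 2 ℕ.^ f) {{_}} {{ℕₚ.m*n≢0 (2 ℕ.^ e) (2 ℕ.^ f)}}
    _ = ℕₚ.m^n≢0 2 (suc (e ℕ.+ f))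

midpoint-dyadic : ∀ {p q} → Dyadic² p → Dyadic² q → Dyadic² (midpoint p q)
midpoint-dyadic (dx , dy) (dx′ , dy′) = mean-dyadic dx dx′ , mean-dyadic dy dy′

combination : ∀ {n} → Vector ℚ n → Vector Point n → Point
combination w v =
  sum (λ i → w i * proj₁ (v i)) , sum (λ i → w i * proj₂ (v i))

-- The rational points of the convex ℝ-hull of v.  Rational weights lose
-- nothing here: a rational point of a segment or of a triangle with rational
-- vertices has rational barycentric coordinates.
Hull : ∀ {n} → Vector Point n → Pred Point 0ℓ
Hull {n} v p = Σ (Vector ℚ n) λ w →
  (∀ i → 0ℚ ≤ w i) × sum w ≡ 1ℚ × p ≡ combination w v

mean-nonNeg : ∀ {x y} → 0ℚ ≤ x → 0ℚ ≤ y → 0ℚ ≤ mean x y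
mean-nonNeg 0≤x 0≤y = *-monoˡ-≤-nonNeg ½ (+-mono-≤ 0≤x 0≤y)

mean-≤ : ∀ {x y q} → x ≤ q → y ≤ q → mean x y ≤ q
mean-≤ {x} {y} {q} x≤q y≤q = ≤-trans
  (*-monoˡ-≤-nonNeg ½ (+-mono-≤ x≤q y≤q))
  (≤-reflexive (solve 1 (λ q → con ½ :* (q :+ q) := q) refl q))

sum-mean : ∀ {n} (f g : Vector ℚ n) →
           sum (λ i → mean (f i) (g i)) ≡ mean (sum f) (sum g)
sum-mean f g = trans (sym (*-distribˡ-sum ½ (λ i → f i + g i)))
                     (cong (½ *_) (∑-distrib-+ f g))

mean-* : ∀ a b c → mean a b * c ≡ mean (a * c) (b * c)
mean-* = solve 4 (λ h a b c → (h :* (a :+ b)) :* c := h :* (a :* c :+ b :* c)) refl ½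

midpoint-hull : ∀ {n} {v : Vector Point n} {p q} →
                Hull v p → Hull v q → Hull v (midpoint p q)
midpoint-hull {v = v} (w , w≥0 , ∑w , refl) (u , u≥0 , ∑u , refl) =
  (λ i → mean (w i) (u i)) ,
  (λ i → mean-nonNeg (w≥0 i) (u≥0 i)) ,
  trans (sum-mean w u) (cong₂ mean ∑w ∑u) ,
  cong₂ _,_ (coordinate proj₁) (coordinate proj₂)
  where
  coordinate : (π : Point → ℚ) →
    mean (sum (λ i → w i * π (v i))) (sum (λ i → u i * π (v i))) ≡
    sum (λ i → mean (w i) (u i) * π (v i))
  coordinate π = sym (trans
    (sum-cong-≗ (λ i → mean-* (w i) (u i) (π (v i))))
    (sum-mean (λ i → w i * π (v i)) (λ i → u i * π (v i))))

-- Groupoids are the library's magmas.  Elements of a subset are compared in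
-- the ambient set, so that membership proofs are irrelevant to equality.
subgroupoid : {A : Set} (_∙_ : Op₂ A) (S : Pred A 0ℓ) →
              (∀ {x y} → S x → S y → S (x ∙ y)) → RawMagma 0ℓ 0ℓ
subgroupoid _∙_ S closed = record
  { Carrier = ∃ S
  ; _≈_     = _≡_ on proj₁
  ; _∙_     = λ (x , x∈S) (y , y∈S) → (x ∙ y) , closed x∈S y∈S
  }

IsGroupoidIsomorphism : (M N : RawMagma 0ℓ 0ℓ) →
                        (RawMagma.Carrier M → RawMagma.Carrier N) → Set
IsGroupoidIsomorphism M N = MagmaMorphisms.IsMagmaIsomorphism M N

dyadicHull : ∀ {n} → Vector Point n → RawMagma 0ℓ 0ℓ
dyadicHull v = subgroupoid midpoint (λ p → Dyadic² p × Hull v p)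
  λ (dp , hp) (dq , hq) → midpoint-dyadic dp dq , midpoint-hull hp hq

interval : Point → Point → RawMagma 0ℓ 0ℓ
interval P Q = dyadicHull (P ∷ Q ∷ [])

standardInterval : ℕ → RawMagma 0ℓ 0ℓ
standardInterval q = subgroupoid mean (λ x → Dyadic x × 0ℚ ≤ x × x ≤ fromℕ q)
  λ (dx , 0≤x , x≤q) (dy , 0≤y , y≤q) →
    mean-dyadic dx dy , mean-nonNeg 0≤x 0≤y , mean-≤ x≤q y≤q

HasType : Point → Point → ℕ → Set
HasType P Q q = Odd q × ∃ (IsGroupoidIsomorphism (interval P Q) (standardInterval q))

-- Twice the signed area of PQR, positive for counterclockwise order.
cross : Point → Point → Point → ℚ
cross (x₁ , y₁) (x₂ , y₂) (x₃ , y₃) =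
  (x₂ - x₁) * (y₃ - y₁) - (x₃ - x₁) * (y₂ - y₁)

record DyadicTriangle : Set where
  field
    vertex        : Vector Point 3
    vertex-dyadic : ∀ i → Dyadic² (vertex i)
    nondegenerate : cross (vertex 0F) (vertex 1F) (vertex 2F) ≢ 0ℚ

  groupoid : RawMagma 0ℓ 0ℓ
  groupoid = dyadicHull vertex

  area : ℚ
  area = ½ * ∣ cross (vertex 0F) (vertex 1F) (vertex 2F) ∣

  vertexSet : Setoid 0ℓ 0ℓ
  vertexSet = record
    { Carrier       = ∃ λ p → ∃ λ i → p ≡ vertex i
    ; _≈_           = _≡_ on proj₁
    ; isEquivalence = On.isEquivalence proj₁ isEquivalence
    }

  vertexAt : Fin 3 → Setoid.Carrier vertexSet
  vertexAt i = vertex i , i , refl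

open DyadicTriangle using (vertex; groupoid; vertexSet; vertexAt; area) public

Clockwise : Point → Point → Point → Set
Clockwise P Q R = cross P Q R < 0ℚ

BoundaryType : Set
BoundaryType = ℕ × ℕ × ℕ

HasBoundaryType : DyadicTriangle → BoundaryType → Set
HasBoundaryType T (a , b , c) = Σ (Permutation′ 3) λ σ →
  let P = vertex T (σ ⟨$⟩ʳ 0F)
      Q = vertex T (σ ⟨$⟩ʳ 1F)
      R = vertex T (σ ⟨$⟩ʳ 2F)
  in Clockwise P Q R × HasType P Q a × HasType Q R b × HasType R P c

rotate : BoundaryType → BoundaryType
rotate (a , b , c) = b , c , a

opposite : BoundaryType → BoundaryType
opposite (a , b , c) = c , b , a

infix 4 _≈cyc_

_≈cyc_ : BoundaryType → BoundaryType → Set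
s ≈cyc t = s ≡ t ⊎ s ≡ rotate t ⊎ s ≡ rotate (rotate t)

EqualBoundaryTypes : DyadicTriangle → DyadicTriangle → Set
EqualBoundaryTypes T T′ = ∃₂ λ s t →
  HasBoundaryType T s × HasBoundaryType T′ t × s ≈cyc t

OppositeBoundaryTypes : DyadicTriangle → DyadicTriangle → Set
OppositeBoundaryTypes T T′ = ∃₂ λ s t →
  HasBoundaryType T s × HasBoundaryType T′ t × s ≈cyc opposite t

VertexBijection : DyadicTriangle → DyadicTriangle → Set
VertexBijection T T′ = Bijection (vertexSet T) (vertexSet T′)

module _ (T T′ : DyadicTriangle) (ι : VertexBijection T T′) where

  image : Fin 3 → Point
  image i = proj₁ (Bijection.to ι (vertexAt T i))

  -- ι is the restriction to vertices of an isomorphism f : T → T′.  An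
  -- element of the groupoid carries a membership proof, hence the
  -- quantification over x.
  IsIsomorphism : Set
  IsIsomorphism =
    Σ (RawMagma.Carrier (groupoid T) → RawMagma.Carrier (groupoid T′)) λ f →
      IsGroupoidIsomorphism (groupoid T) (groupoid T′) f ×
      (∀ i x → proj₁ x ≡ vertex T i → proj₁ (f x) ≡ image i)

  -- ι : ABC → XYZ.  Here X, Y, Z are images of vertices of T, listed in the
  -- order in which they are the vertices of T′; for T′ = hat k l n this says
  -- X = (0,0), Y = (k,l), Z = (n,0).
  ABC→ : Point → Point → Point → Set
  ABC→ X Y Z = X ≡ vertex T′ 0F × Y ≡ vertex T′ 1F × Z ≡ vertex T′ 2F

hat : ℤ → (j m : ℕ) → .{{ℕ.NonZero j}} → .{{ℕ.NonZero m}} → DyadicTriangle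
hat i j m = record
  { vertex        = v
  ; vertex-dyadic = d
  ; nondegenerate = λ cross≡0 → <⇒≢ mj>0
      (sym (neg-injective {mj} {0ℚ} (trans (sym cross≡-mj) cross≡0)))
  }
  where
  v : Vector Point 3
  v = (0ℚ , 0ℚ) ∷ (fromℤ i , fromℕ j) ∷ (fromℕ m , 0ℚ) ∷ []

  mj : ℚ
  mj = fromℕ m * fromℕ j

  mj>0 : 0ℚ < mj
  mj>0 = positive⁻¹ mj
    {{pos*pos⇒pos (fromℕ m) {{normalize-pos m 1}} (fromℕ j) {{normalize-pos j 1}}}}

  cross≡-mj : cross (v 0F) (v 1F) (v 2F) ≡ - mj
  cross≡-mj = solve 3
    (λ i j m → (i :+ :- con 0ℚ) :* (con 0ℚ :+ :- con 0ℚ) :+ :- ((m :+ :- con 0ℚ) :* (j :+ :- con 0ℚ))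
             := :- (m :* j))
    refl (fromℤ i) (fromℕ j) (fromℕ m)

  d : ∀ k → Dyadic² (v k)
  d 0F = fromℤ-dyadic 0ℤ , fromℤ-dyadic 0ℤ
  d 1F = fromℤ-dyadic i , fromℤ-dyadic (+ j)
  d 2F = fromℤ-dyadic (+ m) , fromℤ-dyadic 0ℤ

module Submission where

-- A midpoint-preserving map is, up to a translation, additive on the points of
-- T of the form (x , y) / 2ˢ, which makes every isomorphism affine.  Its linear
-- part has dyadic rows r, s determined by m r = C′ - A′ and i r + j s = B′ - A′;
-- as m and j are odd, r and s are integral, and these divisibilities together
-- with m j = n l (equal areas) are exactly the stated criteria.  Conversely
-- the criteria produce integral r, s with determinant ±1, and the adjugate
-- matrix gives the inverse.

open import Defs
open import Algebra.Bundles using (CommutativeRing; RawMagma)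
open import Algebra.Morphism.Structures using (module MagmaMorphisms)
open import Data.Empty using (⊥-elim)
open import Data.Fin.Base using (Fin)
open import Data.Fin.Patterns using (0F; 1F; 2F)
open import Data.Fin.Permutation as Perm using (Permutation′; _⟨$⟩ʳ_; _⟨$⟩ˡ_; permutation)
open import Data.Integer.Base as ℤ using (ℤ; 0ℤ; 1ℤ; -1ℤ)
open import Data.Integer.Divisibility.Signed as Signed using (∣ᵤ⇒∣; ∣⇒∣ᵤ; divides)
import Data.Integer.Properties as ℤₚ
open import Data.Nat.Base as ℕ using (ℕ; zero; suc)
import Data.Nat.Divisibility as ℕ
import Data.Nat.Properties as ℕₚ
open import Data.Product.Base using (∃; ∃₂; _×_; _,_; proj₁; proj₂)
open import Data.Sum.Base using (_⊎_; inj₁; inj₂)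
open import Data.Vec.Functional using (Vector; []; _∷_)
open import Function.Base using (_∘_)
open import Function.Bundles using (_⇔_; mk⇔; Bijection)
open import Relation.Binary.PropositionalEquality

-- The equation `m r = C′ - A′` by itself only makes r rational. That r is dyadic, so that the odd
-- factor m can be removed, has to come from the value of the isomorphism at an actual point of T;
-- hence additivity is proved on a lattice of points inside T. T is not closed under addition, and
-- for i > 0 it contains no positive multiple of (0 , 1), so the lattice is spanned by (1 , 0) and a
-- slanted vector (a , 1), both scaled by a small enough power of 1/2.
--
-- In the first two criteria the base of T goes to the base of T′, and the equality of areas leaves
-- only a shear and the sign of the base. In the other four the base of T goes to another side.
-- There the equations for r and s make n a common divisor of j and of e = i or e = m - i, and also
-- an integral combination of the two, hence their gcd; the same combination divided by n is the
-- determinant condition.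

module Geometry where
  open import Data.Integer.Base using (+_; -[1+_])
  open import Data.Rational.Base
  open import Data.Rational.Properties
  open import Data.Rational.Solver using (module +-*-Solver)
  import Data.Rational.Unnormalised.Base as ℚᵘ
  import Data.Rational.Unnormalised.Properties as ℚᵘₚ
  open import Algebra.Properties.Group +-0-group using (∙-cancelʳ)
  open import Algebra.Properties.Semiring.Sum (CommutativeRing.semiring +-*-commutativeRing)
    using (sum; sum-permute; sum-cong-≗)
  open +-*-Solver using (solve; _:=_; _:+_; _:*_; _:-_; :-_; con)

  -- Reduces p ≡ q to the ring identity p - q = u - v when u ≡ v is known.
  balance : ∀ {p q u v : ℚ} → u ≡ v → p + v ≡ q + u → p ≡ q
  balance {v = v} refl = ∙-cancelʳ v _ _

  -- Integers and naturals inside the rationals.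

  /-toℚᵘ : ∀ a n .{{_ : ℕ.NonZero n}} → toℚᵘ (a / n) ℚᵘ.≃ (a ℚᵘ./ n)
  /-toℚᵘ a (suc n) = toℚᵘ-fromℚᵘ (ℚᵘ.mkℚᵘ a n)

  fromℤ-toℚᵘ : ∀ a → toℚᵘ (fromℤ a) ℚᵘ.≃ ℚᵘ.mkℚᵘ a 0
  fromℤ-toℚᵘ a = /-toℚᵘ a 1

  fromℤ-+ : ∀ a b → fromℤ (a ℤ.+ b) ≡ fromℤ a + fromℤ b
  fromℤ-+ a b = toℚᵘ-injective (ℚᵘₚ.≃-trans (fromℤ-toℚᵘ (a ℤ.+ b)) (ℚᵘₚ.≃-trans
    (ℚᵘ.*≡* (cong (ℤ._* 1ℤ) (cong₂ ℤ._+_ (sym (ℤₚ.*-identityʳ a)) (sym (ℤₚ.*-identityʳ b)))))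
    (ℚᵘₚ.≃-sym (ℚᵘₚ.≃-trans (toℚᵘ-homo-+ (fromℤ a) (fromℤ b))
      (ℚᵘₚ.+-cong (fromℤ-toℚᵘ a) (fromℤ-toℚᵘ b))))))

  fromℤ-* : ∀ a b → fromℤ (a ℤ.* b) ≡ fromℤ a * fromℤ b
  fromℤ-* a b = toℚᵘ-injective (ℚᵘₚ.≃-trans (fromℤ-toℚᵘ (a ℤ.* b))
    (ℚᵘₚ.≃-sym (ℚᵘₚ.≃-trans (toℚᵘ-homo-* (fromℤ a) (fromℤ b))
      (ℚᵘₚ.*-cong (fromℤ-toℚᵘ a) (fromℤ-toℚᵘ b)))))

  fromℤ-neg : ∀ a → fromℤ (ℤ.- a) ≡ - fromℤ a
  fromℤ-neg a = toℚᵘ-injective (ℚᵘₚ.≃-trans (fromℤ-toℚᵘ (ℤ.- a))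
    (ℚᵘₚ.≃-sym (ℚᵘₚ.≃-trans (toℚᵘ-homo‿- (fromℤ a)) (ℚᵘₚ.-‿cong (fromℤ-toℚᵘ a)))))

  fromℤ-sub : ∀ a b → fromℤ (a ℤ.- b) ≡ fromℤ a - fromℤ b
  fromℤ-sub a b = trans (fromℤ-+ a (ℤ.- b)) (cong (_+_ (fromℤ a)) (fromℤ-neg b))

  fromℤ-injective : ∀ {a b} → fromℤ a ≡ fromℤ b → a ≡ b
  fromℤ-injective {a} {b} eq = ℤₚ.*-cancelʳ-≡ a b 1ℤ (ℚᵘₚ.drop-*≡* (ℚᵘₚ.≃-trans
    (ℚᵘₚ.≃-sym (fromℤ-toℚᵘ a)) (ℚᵘₚ.≃-trans (ℚᵘₚ.≃-reflexive (cong toℚᵘ eq)) (fromℤ-toℚᵘ b))))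

  fromℕ-+ : ∀ a b → fromℕ (a ℕ.+ b) ≡ fromℕ a + fromℕ b
  fromℕ-+ a b = trans (cong fromℤ (ℤₚ.pos-+ a b)) (fromℤ-+ (+ a) (+ b))

  fromℕ-* : ∀ a b → fromℕ (a ℕ.* b) ≡ fromℕ a * fromℕ b
  fromℕ-* a b = trans (cong fromℤ (ℤₚ.pos-* a b)) (fromℤ-* (+ a) (+ b))

  fromℕ-nonNeg : ∀ a → 0ℚ ≤ fromℕ a
  fromℕ-nonNeg a = nonNegative⁻¹ (fromℕ a) {{normalize-nonNeg a 1}}

  *-nonNeg : ∀ {p q} → 0ℚ ≤ p → 0ℚ ≤ q → 0ℚ ≤ p * q
  *-nonNeg {p} {q} 0≤p 0≤q =
    subst (_≤ p * q) (*-zeroʳ p) (*-monoˡ-≤-nonNeg p {{nonNegative 0≤p}} 0≤q)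

  p≤q⇒0≤q-p : ∀ {p q} → p ≤ q → 0ℚ ≤ q - p
  p≤q⇒0≤q-p {p} {q} p≤q = subst (_≤ q - p) (+-inverseʳ p) (+-monoˡ-≤ (- p) p≤q)

  fromℕ-mono-≤ : ∀ {a b} → a ℕ.≤ b → fromℕ a ≤ fromℕ b
  fromℕ-mono-≤ {a} {b} a≤b = subst₂ _≤_ (+-identityʳ (fromℕ a))
    (trans (sym (fromℕ-+ a (b ℕ.∸ a))) (cong fromℕ (ℕₚ.m+[n∸m]≡n a≤b)))
    (+-monoʳ-≤ (fromℕ a) (fromℕ-nonNeg (b ℕ.∸ a)))

  *-/ : ∀ n a .{{_ : ℕ.NonZero n}} → fromℕ n * (a / n) ≡ fromℤ a
  *-/ n@(suc n-1) a = toℚᵘ-injective (ℚᵘₚ.≃-trans (toℚᵘ-homo-* (fromℕ n) (a / n))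
    (ℚᵘₚ.≃-trans (ℚᵘₚ.*-cong (fromℤ-toℚᵘ (+ n)) (/-toℚᵘ a n))
    (ℚᵘₚ.≃-trans (ℚᵘ.*≡* eq) (ℚᵘₚ.≃-sym (fromℤ-toℚᵘ a)))))
    where
    eq : (+ n ℤ.* a) ℤ.* + 1 ≡ a ℤ.* + (1 ℕ.* n)
    eq = trans (ℤₚ.*-identityʳ (+ n ℤ.* a)) (trans (ℤₚ.*-comm (+ n) a)
      (cong (λ k → a ℤ.* + k) (sym (ℕₚ.*-identityˡ n))))

  *-cancelˡ : ∀ n .{{_ : ℕ.NonZero n}} {p q} → fromℕ n * p ≡ fromℕ n * q → p ≡ q
  *-cancelˡ n {p} {q} eq = begin
    p                         ≡⟨ divided p ⟩
    (1ℤ / n) * (fromℕ n * p)  ≡⟨ cong ((1ℤ / n) *_) eq ⟩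
    (1ℤ / n) * (fromℕ n * q)  ≡⟨ divided q ⟨
    q                         ∎
    where
    open ≡-Reasoning
    divided : ∀ x → x ≡ (1ℤ / n) * (fromℕ n * x)
    divided x = sym (trans
      (solve 3 (λ i n x → i :* (n :* x) := (n :* i) :* x) refl (1ℤ / n) (fromℕ n) x)
      (trans (cong (_* x) (*-/ n 1ℤ)) (*-identityˡ x)))

  ≡-/ : ∀ n a .{{_ : ℕ.NonZero n}} {q} → fromℕ n * q ≡ fromℤ a → q ≡ a / n
  ≡-/ n a eq = *-cancelˡ n (trans eq (sym (*-/ n a)))

  -- Integral and dyadic rationals; removal of odd denominators.

  Integral : ℚ → Set
  Integral q = ∃ λ a → q ≡ fromℤ a

  integral-fromℕ : ∀ n → Integral (fromℕ n)
  integral-fromℕ n = + n , refl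

  integral-+ : ∀ {p q} → Integral p → Integral q → Integral (p + q)
  integral-+ (a , refl) (b , refl) = a ℤ.+ b , sym (fromℤ-+ a b)

  integral-* : ∀ {p q} → Integral p → Integral q → Integral (p * q)
  integral-* (a , refl) (b , refl) = a ℤ.* b , sym (fromℤ-* a b)

  integral-neg : ∀ {p} → Integral p → Integral (- p)
  integral-neg (a , refl) = ℤ.- a , sym (fromℤ-neg a)

  two^ : ℕ → ℚ
  two^ e = fromℕ (2 ℕ.^ e)

  two^-+ : ∀ e f → two^ (e ℕ.+ f) ≡ two^ e * two^ f
  two^-+ e f = trans (cong fromℕ (ℕₚ.^-distribˡ-+-* 2 e f)) (fromℕ-* (2 ℕ.^ e) (2 ℕ.^ f))

  dyadic⇒integral : ∀ {q} → Dyadic q → ∃ λ e → Integral (two^ e * q)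
  dyadic⇒integral (a , e , refl) = e , a , *-/ (2 ℕ.^ e) a {{ℕₚ.m^n≢0 2 e}}

  integral⇒dyadic : ∀ {q} e → Integral (two^ e * q) → Dyadic q
  integral⇒dyadic e (a , eq) = a , e , ≡-/ (2 ℕ.^ e) a {{ℕₚ.m^n≢0 2 e}} eq

  dyadic-+ : ∀ {p q} → Dyadic p → Dyadic q → Dyadic (p + q)
  dyadic-+ {p} {q} dp dq with dyadic⇒integral dp | dyadic⇒integral dq
  ... | e , ip | f , iq = integral⇒dyadic (e ℕ.+ f) (subst Integral
    (trans (solve 4 (λ E F p q → F :* (E :* p) :+ E :* (F :* q) := E :* F :* (p :+ q)) refl
             (two^ e) (two^ f) p q)
           (cong (_* (p + q)) (sym (two^-+ e f))))
    (integral-+ (integral-* (integral-fromℕ (2 ℕ.^ f)) ip) (integral-* (integral-fromℕ (2 ℕ.^ e)) iq)))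

  dyadic-* : ∀ {p q} → Dyadic p → Dyadic q → Dyadic (p * q)
  dyadic-* {p} {q} dp dq with dyadic⇒integral dp | dyadic⇒integral dq
  ... | e , ip | f , iq = integral⇒dyadic (e ℕ.+ f) (subst Integral
    (trans (solve 4 (λ E F p q → (E :* p) :* (F :* q) := E :* F :* (p :* q)) refl
             (two^ e) (two^ f) p q)
           (cong (_* (p * q)) (sym (two^-+ e f))))
    (integral-* ip iq))

  dyadic-neg : ∀ {p} → Dyadic p → Dyadic (- p)
  dyadic-neg {p} dp with dyadic⇒integral dp
  ... | e , ip = integral⇒dyadic e (subst Integral
    (solve 2 (λ E p → :- (E :* p) := E :* (:- p)) refl (two^ e) p) (integral-neg ip))

  dyadic-- : ∀ {p q} → Dyadic p → Dyadic q → Dyadic (p - q)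
  dyadic-- dp dq = dyadic-+ dp (dyadic-neg dq)

  -- Descent on e: with m = 2h + 1, q = m q - h (2 q).
  odd-denominator : ∀ h e {q} → Integral (two^ e * q) →
    Integral (fromℕ (1 ℕ.+ 2 ℕ.* h) * q) → Integral q
  odd-denominator h zero {q} i _ = subst Integral (*-identityˡ q) i
  odd-denominator h (suc e) {q} i im = subst Integral
    (balance (cong (_* q) m-split) (solve 3 (λ m h q →
        m :* q :+ (:- (h :* (con two :* q))) :+ (con 1ℚ :+ con two :* h) :* q := q :+ m :* q)
      refl (fromℕ m) (fromℕ h) q))
    (integral-+ im (integral-neg (integral-* (integral-fromℕ h) 2q)))
    where
    m = 1 ℕ.+ 2 ℕ.* h
    two = fromℕ 2
    m-split : fromℕ m ≡ 1ℚ + two * fromℕ h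
    m-split = trans (fromℕ-+ 1 (2 ℕ.* h)) (cong (λ x → 1ℚ + x) (fromℕ-* 2 h))
    2q : Integral (two * q)
    2q = odd-denominator h e
      (subst Integral (trans (cong (_* q) (fromℕ-* 2 (2 ℕ.^ e)))
         (solve 2 (λ E q → con two :* E :* q := E :* (con two :* q)) refl (two^ e) q)) i)
      (subst Integral (solve 2 (λ m q → con two :* (m :* q) := m :* (con two :* q)) refl (fromℕ m) q)
         (integral-* (integral-fromℕ 2) im))

  odd-half : ∀ n → Odd n → ∃ λ h → n ≡ 1 ℕ.+ 2 ℕ.* h
  odd-half 0 odd = ⊥-elim (odd (ℕ.divides 0 refl))
  odd-half 1 odd = 0 , refl
  odd-half (suc (suc n)) odd with odd-half n (λ 2∣n → odd (ℕ.∣m∣n⇒∣m+n ℕ.∣-refl 2∣n))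
  ... | h , refl = suc h , cong suc (sym (ℕₚ.*-suc 2 h))

  integral-of-odd-multiple : ∀ n → Odd n → ∀ {q} → Dyadic q → Integral (fromℕ n * q) → Integral q
  integral-of-odd-multiple n odd dq inq with odd-half n odd | dyadic⇒integral dq
  ... | h , refl | e , iq = odd-denominator h e iq inq

  -- Membership of points in triangles.

  Carrier : DyadicTriangle → Set
  Carrier T = RawMagma.Carrier (groupoid T)

  vertex-hull : (v : Vector Point 3) → ∀ t → Hull v (v t)
  vertex-hull v 0F = 1ℚ ∷ 0ℚ ∷ 0ℚ ∷ [] ,
    (λ { 0F → nonNegative⁻¹ 1ℚ ; 1F → ≤-refl ; 2F → ≤-refl }) , refl , cong₂ _,_ (first proj₁) (first proj₂)
    where
    first : (π : Point → ℚ) → π (v 0F) ≡ 1ℚ * π (v 0F) + (0ℚ * π (v 1F) + (0ℚ * π (v 2F) + 0ℚ))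
    first π = solve 3 (λ a b c → a := con 1ℚ :* a :+ (con 0ℚ :* b :+ (con 0ℚ :* c :+ con 0ℚ)))
      refl (π (v 0F)) (π (v 1F)) (π (v 2F))
  vertex-hull v 1F = 0ℚ ∷ 1ℚ ∷ 0ℚ ∷ [] ,
    (λ { 0F → ≤-refl ; 1F → nonNegative⁻¹ 1ℚ ; 2F → ≤-refl }) , refl , cong₂ _,_ (second proj₁) (second proj₂)
    where
    second : (π : Point → ℚ) → π (v 1F) ≡ 0ℚ * π (v 0F) + (1ℚ * π (v 1F) + (0ℚ * π (v 2F) + 0ℚ))
    second π = solve 3 (λ a b c → b := con 0ℚ :* a :+ (con 1ℚ :* b :+ (con 0ℚ :* c :+ con 0ℚ)))
      refl (π (v 0F)) (π (v 1F)) (π (v 2F))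
  vertex-hull v 2F = 0ℚ ∷ 0ℚ ∷ 1ℚ ∷ [] ,
    (λ { 0F → ≤-refl ; 1F → ≤-refl ; 2F → nonNegative⁻¹ 1ℚ }) , refl , cong₂ _,_ (third proj₁) (third proj₂)
    where
    third : (π : Point → ℚ) → π (v 2F) ≡ 0ℚ * π (v 0F) + (0ℚ * π (v 1F) + (1ℚ * π (v 2F) + 0ℚ))
    third π = solve 3 (λ a b c → c := con 0ℚ :* a :+ (con 0ℚ :* b :+ (con 1ℚ :* c :+ con 0ℚ)))
      refl (π (v 0F)) (π (v 1F)) (π (v 2F))

  vertex∈ : ∀ T → Fin 3 → Carrier T
  vertex∈ T t = vertex T t , DyadicTriangle.vertex-dyadic T t , vertex-hull (vertex T) t

  -- J = 1/j, M = 1/m and z = j x - i y, so the last two barycentric coordinates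
  -- of (x , y) are y / j and z / (m j).
  hat-hull : ∀ {i j m J M x y z : ℚ} → j * J ≡ 1ℚ → m * M ≡ 1ℚ → 0ℚ ≤ J → 0ℚ ≤ M →
    j * x ≡ z + i * y → 0ℚ ≤ y → 0ℚ ≤ z → m * y + z ≤ m * j →
    Hull ((0ℚ , 0ℚ) ∷ (i , j) ∷ (m , 0ℚ) ∷ []) (x , y)
  hat-hull {i} {j} {m} {J} {M} {x} {y} {z} jJ mM 0≤J 0≤M jx 0≤y 0≤z bound =
    (m * j - (m * y + z)) * (J * M) ∷ y * J ∷ z * (J * M) ∷ [] ,
    (λ { 0F → *-nonNeg (p≤q⇒0≤q-p bound) (*-nonNeg 0≤J 0≤M)
       ; 1F → *-nonNeg 0≤y 0≤J
       ; 2F → *-nonNeg 0≤z (*-nonNeg 0≤J 0≤M) }) ,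
    balance {u = (j * J) * (m * M) + m * M + 1ℚ * (y * J)} {1ℚ * (m * M) + 1ℚ + (m * M) * (y * J)}
      (cong₂ _+_ (cong₂ _+_ (cong (_* (m * M)) jJ) mM) (cong (_* (y * J)) (sym mM)))
      (solve 7 (λ i j m J M y z →
          ((m :* j :+ :- (m :* y :+ z)) :* (J :* M) :+ (y :* J :+ (z :* (J :* M) :+ con 0ℚ)))
            :+ (con 1ℚ :* (m :* M) :+ con 1ℚ :+ (m :* M) :* (y :* J))
          := con 1ℚ :+ ((j :* J) :* (m :* M) :+ m :* M :+ con 1ℚ :* (y :* J)))
        refl i j m J M y z) ,
    cong₂ _,_
      (balance {u = 1ℚ * x + (j * x) * J + 1ℚ * (z * J)} {(j * J) * x + (z + i * y) * J + (m * M) * (z * J)}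
        (cong₂ _+_ (cong₂ _+_ (cong (_* x) (sym jJ)) (cong (_* J) jx)) (cong (_* (z * J)) (sym mM)))
        (solve 8 (λ i j m J M x y z →
            x :+ ((j :* J) :* x :+ (z :+ i :* y) :* J :+ (m :* M) :* (z :* J))
            := ((m :* j :+ :- (m :* y :+ z)) :* (J :* M) :* con 0ℚ :+ (y :* J :* i :+ (z :* (J :* M) :* m :+ con 0ℚ)))
              :+ (con 1ℚ :* x :+ (j :* x) :* J :+ con 1ℚ :* (z :* J)))
          refl i j m J M x y z))
      (balance {u = 1ℚ * y} {(j * J) * y} (cong (_* y) (sym jJ))
        (solve 7 (λ i j m J M y z →
            y :+ (j :* J) :* y
            := ((m :* j :+ :- (m :* y :+ z)) :* (J :* M) :* con 0ℚ :+ (y :* J :* j :+ (z :* (J :* M) :* con 0ℚ :+ con 0ℚ)))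
              :+ con 1ℚ :* y)
          refl i j m J M y z))

  -- From midpoint-preserving maps to integral linear parts.

  ½^ : ℕ → ℚ
  ½^ zero    = 1ℚ
  ½^ (suc s) = ½ * ½^ s

  ½^-nonNeg : ∀ s → 0ℚ ≤ ½^ s
  ½^-nonNeg zero    = nonNegative⁻¹ 1ℚ
  ½^-nonNeg (suc s) = *-nonNeg (nonNegative⁻¹ ½) (½^-nonNeg s)

  two^-½^ : ∀ s → two^ s * ½^ s ≡ 1ℚ
  two^-½^ zero    = refl
  two^-½^ (suc s) = trans (cong (_* (½ * ½^ s)) (fromℕ-* 2 (2 ℕ.^ s)))
    (trans (solve 2 (λ t h → con (fromℕ 2) :* t :* (con ½ :* h) := t :* h) refl (two^ s) (½^ s))
           (two^-½^ s))

  dyadic-½^ : ∀ s → Dyadic (½^ s)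
  dyadic-½^ zero    = fromℤ-dyadic 1ℤ
  dyadic-½^ (suc s) = dyadic-* {½} (1ℤ , 1 , refl) (dyadic-½^ s)

  -- Supplies the slope of the second lattice vector: `u = a j - i ≥ 0` says that (a , 1) lies on
  -- the inner side of AB. For i ≥ 0 the choice a = i suffices because j ≥ 1; for i < 0 the vertical
  -- direction, a = 0, already does.
  dominating-multiple : ∀ i j .{{_ : ℕ.NonZero j}} → ∃₂ λ a u → + u ℤ.+ i ≡ + (a ℕ.* j)
  dominating-multiple (+ n)    (suc j) = n , n ℕ.* j , cong +_ (trans (ℕₚ.+-comm (n ℕ.* j) n) (sym (ℕₚ.*-suc n j)))
  dominating-multiple -[1+ n ] j       = 0 , suc n , ℤₚ.n⊖n≡0 (suc n)

  n≤2^n : ∀ n → n ℕ.≤ 2 ℕ.^ n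
  n≤2^n zero    = ℕ.z≤n
  n≤2^n (suc n) = ℕₚ.+-mono-≤ (ℕₚ.m^n>0 2 n) (ℕₚ.≤-trans (n≤2^n n) (ℕₚ.m≤m+n _ 0))

  -- g is the first or second coordinate of an isomorphism, minus its value at
  -- the vertex (0,0).
  module Additive (i : ℤ) (j m : ℕ) .{{_ : ℕ.NonZero j}} .{{_ : ℕ.NonZero m}}
    (g : Carrier (hat i j m) → ℚ)
    (g-cong : ∀ {x y} → proj₁ x ≡ proj₁ y → g x ≡ g y)
    (g-mean : ∀ x y → g (RawMagma._∙_ (groupoid (hat i j m)) x y) ≡ mean (g x) (g y))
    (g-A : g (vertex∈ (hat i j m) 0F) ≡ 0ℚ)
    where

    open RawMagma (groupoid (hat i j m)) using () renaming (_∙_ to _∘ₘ_)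

    A B C : Carrier (hat i j m)
    A = vertex∈ (hat i j m) 0F
    B = vertex∈ (hat i j m) 1F
    C = vertex∈ (hat i j m) 2F

    -- As A is the origin, `z ∘ₘ A` and `x ∘ₘ y` are the same point when z = x + y, and both
    -- midpoints stay inside the triangle. Doubling the two resulting values of `g`, with `g A = 0`,
    -- gives the sum.
    additive : ∀ x y z →
      proj₁ (proj₁ z) ≡ proj₁ (proj₁ x) + proj₁ (proj₁ y) →
      proj₂ (proj₁ z) ≡ proj₂ (proj₁ x) + proj₂ (proj₁ y) → g z ≡ g x + g y
    additive x y z eq₁ eq₂ = begin
      g z                  ≡⟨ solve 1 (λ a → a := con (fromℕ 2) :* (con ½ :* (a :+ con 0ℚ))) refl (g z) ⟩
      fromℕ 2 * mean (g z) 0ℚ     ≡⟨ cong (λ c → fromℕ 2 * mean (g z) c) g-A ⟨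
      fromℕ 2 * mean (g z) (g A)  ≡⟨ cong (fromℕ 2 *_) (g-mean z A) ⟨
      fromℕ 2 * g (z ∘ₘ A)        ≡⟨ cong (fromℕ 2 *_) (g-cong {z ∘ₘ A} {x ∘ₘ y} (cong₂ _,_ (half eq₁) (half eq₂))) ⟩
      fromℕ 2 * g (x ∘ₘ y)        ≡⟨ cong (fromℕ 2 *_) (g-mean x y) ⟩
      fromℕ 2 * mean (g x) (g y)  ≡⟨ solve 2 (λ a b → con (fromℕ 2) :* (con ½ :* (a :+ b)) := a :+ b) refl (g x) (g y) ⟩
      g x + g y ∎
      where
      open ≡-Reasoning
      half : ∀ {a b} → a ≡ b → mean a 0ℚ ≡ ½ * b
      half {a} a≡b = cong (½ *_) (trans (+-identityʳ a) a≡b)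

    -- Scaling by a power of 1/2 expressed through the groupoid operation alone, so that `g` can be
    -- followed along it.
    halve : ℕ → Carrier (hat i j m) → Carrier (hat i j m)
    halve zero    x = x
    halve (suc s) x = halve s x ∘ₘ A

    scaled : ∀ {a b c} → a ≡ b * c → mean a 0ℚ ≡ (½ * b) * c
    scaled {a} {b} {c} eq = trans (cong (½ *_) (trans (+-identityʳ a) eq)) (sym (*-assoc ½ b c))

    halve-x : ∀ s x → proj₁ (proj₁ (halve s x)) ≡ ½^ s * proj₁ (proj₁ x)
    halve-x zero    x = sym (*-identityˡ _)
    halve-x (suc s) x = scaled {b = ½^ s} (halve-x s x)

    halve-y : ∀ s x → proj₂ (proj₁ (halve s x)) ≡ ½^ s * proj₂ (proj₁ x)
    halve-y zero    x = sym (*-identityˡ _)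
    halve-y (suc s) x = scaled {b = ½^ s} (halve-y s x)

    g-halve : ∀ s x → g (halve s x) ≡ ½^ s * g x
    g-halve zero    x = sym (*-identityˡ _)
    g-halve (suc s) x = trans (g-mean (halve s x) A)
      (trans (cong (mean (g (halve s x))) g-A) (scaled {b = ½^ s} (g-halve s x)))

    -- Since a j - i = u ≥ 0, the direction (a , 1) points into the triangle at A.
    -- The points (x (1 , 0) + y (a , 1)) / 2ˢ with x, y ∈ ℕ and weight x y ≤ 2ˢ
    -- lie in the triangle, and s is so large that the multiples of e₁ and e₂
    -- needed to reach C / 2ˢ and B / 2ˢ are among them.
    module Lattice (a u s : ℕ) (u+i : + u ℤ.+ i ≡ + (a ℕ.* j))
      (bound : (j ℕ.+ (m ℕ.+ u)) ℕ.* (m ℕ.+ u ℕ.+ j) ℕ.≤ 2 ℕ.^ s) where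

      u+i≡aj : fromℕ u + fromℤ i ≡ fromℕ a * fromℕ j
      u+i≡aj = trans (sym (fromℤ-+ (+ u) i)) (trans (cong fromℤ u+i) (fromℕ-* a j))

      -- Up to the factor `m j 2ˢ` this is the sum of the barycentric coordinates of the lattice
      -- point at B and C, which must not exceed 1. Since m j ≥ 1, a weight of at most 2ˢ is enough.
      weight : ℕ → ℕ → ℕ
      weight x y = j ℕ.* x ℕ.+ (m ℕ.+ u) ℕ.* y

      private
        h = ½^ s

        1/-nonNeg : ∀ n .{{_ : ℕ.NonZero n}} → 0ℚ ≤ 1ℤ / n
        1/-nonNeg n = nonNegative⁻¹ (1ℤ / n) {{normalize-nonNeg 1 n}}

        1≤mj : 1ℚ ≤ fromℕ m * fromℕ j
        1≤mj = subst (1ℚ ≤_) (fromℕ-* m j) (fromℕ-mono-≤ {1} (ℕₚ.*-mono-≤ (ℕ.>-nonZero⁻¹ m) (ℕ.>-nonZero⁻¹ j)))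

        -- Substituting `i = a j - u` turns the quantity z = j X - i Y that `hat-hull` needs, for
        -- the point (X , Y), into a sum of nonnegative terms.
        jx≡ : ∀ {x y} → fromℕ j * (h * (x + fromℕ a * y)) ≡ h * (fromℕ j * x + fromℕ u * y) + fromℤ i * (h * y)
        jx≡ {x} {y} = balance (cong (_* (h * y)) (sym u+i≡aj))
          (solve 7 (λ i j a u h x y →
             j :* (h :* (x :+ a :* y)) :+ (u :+ i) :* (h :* y) :=
             (h :* (j :* x :+ u :* y) :+ i :* (h :* y)) :+ (a :* j) :* (h :* y)) refl
             (fromℤ i) (fromℕ j) (fromℕ a) (fromℕ u) h x y)

        weight-≡ : ∀ x y → fromℕ m * (h * fromℕ y) + h * (fromℕ j * fromℕ x + fromℕ u * fromℕ y) ≡ h * fromℕ (weight x y)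
        weight-≡ x y = sym (trans
          (cong (h *_) (trans (fromℕ-+ (j ℕ.* x) _) (cong₂ _+_ (fromℕ-* j x)
            (trans (fromℕ-* (m ℕ.+ u) y) (cong (_* fromℕ y) (fromℕ-+ m u))))))
          (solve 6 (λ j m u h x y → h :* (j :* x :+ (m :+ u) :* y) :=
              m :* (h :* y) :+ h :* (j :* x :+ u :* y)) refl
            (fromℕ j) (fromℕ m) (fromℕ u) h (fromℕ x) (fromℕ y)))

      latticePoint : ℕ → ℕ → Point
      latticePoint x y = h * (fromℕ x + fromℕ a * fromℕ y) , h * fromℕ y

      -- Opaque, because comparing two lattice points would otherwise unfold
      -- the membership proofs.
      opaque
        latticePoint∈ : ∀ x y → weight x y ℕ.≤ 2 ℕ.^ s →
          Dyadic² (latticePoint x y) × Hull (vertex (hat i j m)) (latticePoint x y)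
        latticePoint∈ x y w≤ =
          (dyadic-* (dyadic-½^ s) (dyadic-+ (fromℤ-dyadic (+ x)) (dyadic-* (fromℤ-dyadic (+ a)) (fromℤ-dyadic (+ y)))) ,
           dyadic-* (dyadic-½^ s) (fromℤ-dyadic (+ y))) ,
          hat-hull (*-/ j 1ℤ) (*-/ m 1ℤ) (1/-nonNeg j) (1/-nonNeg m)
            (jx≡ {fromℕ x} {fromℕ y})
            (*-nonNeg (½^-nonNeg s) (fromℕ-nonNeg y))
            (*-nonNeg (½^-nonNeg s) (subst (0ℚ ≤_)
              (trans (fromℕ-+ (j ℕ.* x) (u ℕ.* y)) (cong₂ _+_ (fromℕ-* j x) (fromℕ-* u y)))
              (fromℕ-nonNeg (j ℕ.* x ℕ.+ u ℕ.* y))))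
            (≤-trans (≤-reflexive (weight-≡ x y))
            (≤-trans (*-monoˡ-≤-nonNeg h {{nonNegative (½^-nonNeg s)}} (fromℕ-mono-≤ w≤))
            (≤-trans (≤-reflexive (trans (*-comm h (two^ s)) (two^-½^ s))) 1≤mj)))

      lattice : ∀ x y → weight x y ℕ.≤ 2 ℕ.^ s → Carrier (hat i j m)
      lattice x y w≤ = latticePoint x y , latticePoint∈ x y w≤

      g-lattice-+ : ∀ {x y x′ y′} (w : weight x y ℕ.≤ 2 ℕ.^ s) (w′ : weight x′ y′ ℕ.≤ 2 ℕ.^ s)
        (w″ : weight (x ℕ.+ x′) (y ℕ.+ y′) ℕ.≤ 2 ℕ.^ s) →
        g (lattice (x ℕ.+ x′) (y ℕ.+ y′) w″) ≡ g (lattice x y w) + g (lattice x′ y′ w′)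
      g-lattice-+ {x} {y} {x′} {y′} w w′ w″ = additive (lattice x y w) (lattice x′ y′ w′) (lattice (x ℕ.+ x′) (y ℕ.+ y′) w″)
        (trans (cong₂ (λ X Y → h * (X + fromℕ a * Y)) (fromℕ-+ x x′) (fromℕ-+ y y′))
          (solve 6 (λ h a x x′ y y′ → h :* ((x :+ x′) :+ a :* (y :+ y′)) :=
             h :* (x :+ a :* y) :+ h :* (x′ :+ a :* y′)) refl h (fromℕ a) (fromℕ x) (fromℕ x′) (fromℕ y) (fromℕ y′)))
        (trans (cong (h *_) (fromℕ-+ y y′)) (*-distribˡ-+ h (fromℕ y) (fromℕ y′)))

      -- Induction on `t` never leaves the triangle, because `weight` grows with `t`. The
      -- coordinates enter through equations since `m` and `0` do not reduce to the products `m * 1`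
      -- and `m * 0`.
      g-lattice-* : ∀ t {dx dy x y} → x ≡ t ℕ.* dx → y ≡ t ℕ.* dy →
        (w : weight x y ℕ.≤ 2 ℕ.^ s) (w₁ : weight dx dy ℕ.≤ 2 ℕ.^ s) →
        g (lattice x y w) ≡ fromℕ t * g (lattice dx dy w₁)
      g-lattice-* zero {dx} {dy} refl refl w w₁ = begin
        g (lattice 0 0 w) ≡⟨ g-cong {lattice 0 0 w} {A} (cong₂ _,_
          (solve 2 (λ h a → h :* (con 0ℚ :+ a :* con 0ℚ) := con 0ℚ) refl h (fromℕ a)) (*-zeroʳ h)) ⟩
        g A               ≡⟨ g-A ⟩
        0ℚ                ≡⟨ *-zeroˡ (g (lattice dx dy w₁)) ⟨
        0ℚ * g (lattice dx dy w₁) ∎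
        where open ≡-Reasoning
      g-lattice-* (suc t) {dx} {dy} refl refl w w₁ = begin
        g (lattice (suc t ℕ.* dx) (suc t ℕ.* dy) w)
          ≡⟨ g-lattice-+ {dx} {dy} {t ℕ.* dx} {t ℕ.* dy} w₁ w′ w ⟩
        G + g (lattice (t ℕ.* dx) (t ℕ.* dy) w′)
          ≡⟨ cong (λ x → G + x) (g-lattice-* t refl refl w′ w₁) ⟩
        G + fromℕ t * G
          ≡⟨ solve 2 (λ G t → G :+ t :* G := (con 1ℚ :+ t) :* G) refl G (fromℕ t) ⟩
        (1ℚ + fromℕ t) * G
          ≡⟨ cong (_* G) (fromℕ-+ 1 t) ⟨
        fromℕ (suc t) * G ∎
        where
        open ≡-Reasoning
        G = g (lattice dx dy w₁)
        w′ : weight (t ℕ.* dx) (t ℕ.* dy) ℕ.≤ 2 ℕ.^ s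
        w′ = ℕₚ.≤-trans (ℕₚ.+-mono-≤ (ℕₚ.*-monoʳ-≤ j (ℕₚ.m≤n+m (t ℕ.* dx) dx))
                                     (ℕₚ.*-monoʳ-≤ (m ℕ.+ u) (ℕₚ.m≤n+m (t ℕ.* dy) dy))) w

      -- `m + u + j` is merely a common bound for 1, m, u and j, the only coordinates at which
      -- lattice points are evaluated below.
      weight-≤ : ∀ x y → x ℕ.≤ m ℕ.+ u ℕ.+ j → y ℕ.≤ m ℕ.+ u ℕ.+ j → weight x y ℕ.≤ 2 ℕ.^ s
      weight-≤ x y x≤ y≤ = ℕₚ.≤-trans (ℕₚ.+-mono-≤ (ℕₚ.*-monoʳ-≤ j x≤) (ℕₚ.*-monoʳ-≤ (m ℕ.+ u) y≤))
        (ℕₚ.≤-trans (ℕₚ.≤-reflexive (sym (ℕₚ.*-distribʳ-+ (m ℕ.+ u ℕ.+ j) j (m ℕ.+ u)))) bound)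

      1≤ : 1 ℕ.≤ m ℕ.+ u ℕ.+ j
      1≤ = ℕₚ.≤-trans (ℕ.>-nonZero⁻¹ j) (ℕₚ.m≤n+m j (m ℕ.+ u))

      e₁ e₂ : Carrier (hat i j m)
      e₁ = lattice 1 0 (weight-≤ 1 0 1≤ ℕ.z≤n)
      e₂ = lattice 0 1 (weight-≤ 0 1 ℕ.z≤n 1≤)

      m-e₁ : fromℕ m * g e₁ ≡ h * g C
      m-e₁ = begin
        fromℕ m * g e₁                           ≡⟨ g-lattice-* m (sym (ℕₚ.*-identityʳ m)) (sym (ℕₚ.*-zeroʳ m)) w _ ⟨
        g (lattice m 0 w)                        ≡⟨ g-cong {lattice m 0 w} {halve s C} (cong₂ _,_
          (trans (solve 3 (λ h m a → h :* (m :+ a :* con 0ℚ) := h :* m) refl h (fromℕ m) (fromℕ a)) (sym (halve-x s C)))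
          (sym (halve-y s C))) ⟩
        g (halve s C)                            ≡⟨ g-halve s C ⟩
        h * g C                                  ∎
        where
        open ≡-Reasoning
        w = weight-≤ m 0 (ℕₚ.≤-trans (ℕₚ.m≤m+n m u) (ℕₚ.m≤m+n (m ℕ.+ u) j)) ℕ.z≤n

      -- The relation B / 2ˢ = j e₂ - u e₁, rearranged so that only sums of points of the triangle
      -- occur: `additive` knows nothing about differences.
      j-e₂ : fromℕ j * g e₂ ≡ h * g B + fromℕ u * g e₁
      j-e₂ = begin
        fromℕ j * g e₂                           ≡⟨ g-lattice-* j (sym (ℕₚ.*-zeroʳ j)) (sym (ℕₚ.*-identityʳ j)) w _ ⟨
        g (lattice 0 j w)                        ≡⟨ additive (halve s B) (lattice u 0 w′) (lattice 0 j w)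
          (trans (balance (sym (cong (h *_) u+i≡aj)) (solve 5 (λ h a i u j →
                   h :* (con 0ℚ :+ a :* j) :+ h :* (u :+ i) :=
                   h :* i :+ h :* (u :+ a :* con 0ℚ) :+ h :* (a :* j))
                  refl h (fromℕ a) (fromℤ i) (fromℕ u) (fromℕ j)))
            (cong (_+ h * (fromℕ u + fromℕ a * 0ℚ)) (sym (halve-x s B))))
          (trans (solve 2 (λ h j → h :* j := h :* j :+ h :* con 0ℚ) refl h (fromℕ j))
            (cong (_+ h * 0ℚ) (sym (halve-y s B)))) ⟩
        g (halve s B) + g (lattice u 0 w′)       ≡⟨ cong₂ _+_ (g-halve s B)
                                                    (g-lattice-* u (sym (ℕₚ.*-identityʳ u)) (sym (ℕₚ.*-zeroʳ u)) w′ _) ⟩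
        h * g B + fromℕ u * g e₁                 ∎
        where
        open ≡-Reasoning
        w = weight-≤ 0 j ℕ.z≤n (ℕₚ.m≤n+m j (m ℕ.+ u))
        w′ = weight-≤ u 0 (ℕₚ.≤-trans (ℕₚ.m≤n+m u m) (ℕₚ.m≤m+n (m ℕ.+ u) j)) ℕ.z≤n

      -- The values of the linear extension of `g` at (1 , 0) and at (0 , 1) = (a , 1) - a (1 , 0).
      -- Both are integral combinations of values of `g` at points of the triangle.
      r s′ : ℚ
      r  = two^ s * g e₁
      s′ = two^ s * g e₂ - fromℕ a * r

      m-r : fromℕ m * r ≡ g C
      m-r = balance (cong₂ _+_ (cong (two^ s *_) m-e₁) (cong (_* g C) (two^-½^ s)))
        (solve 5 (λ m t h e c → m :* (t :* e) :+ (t :* (h :* c) :+ con 1ℚ :* c) := c :+ (t :* (m :* e) :+ t :* h :* c))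
          refl (fromℕ m) (two^ s) h (g e₁) (g C))

      j-s′ : fromℕ j * s′ ≡ g B - fromℤ i * r
      j-s′ = balance (cong₂ _+_ (cong₂ _+_ (cong (two^ s *_) j-e₂) (cong (_* g B) (two^-½^ s))) (cong (_* (two^ s * g e₁)) u+i≡aj))
        (solve 9 (λ i j a u t h e f b →
            j :* (t :* f :+ :- (a :* (t :* e))) :+ (t :* (h :* b :+ u :* e) :+ con 1ℚ :* b :+ a :* j :* (t :* e))
            := (b :+ :- (i :* (t :* e))) :+ (t :* (j :* f) :+ t :* h :* b :+ (u :+ i) :* (t :* e)))
          refl (fromℤ i) (fromℕ j) (fromℕ a) (fromℕ u) (two^ s) h (g e₁) (g e₂) (g B))

  -- `π` is a coordinate projection, so each use yields one column of the matrix. The coefficient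
  -- `r` is 2ˢ times a difference of coordinates of dyadic points, hence dyadic, and `m r` is an
  -- integer with m odd; so `r` is an integer. Only then is `j s` an integer too, and the same
  -- argument applies to `s` with j odd.
  linear-coordinate : ∀ i j m .{{_ : ℕ.NonZero j}} .{{_ : ℕ.NonZero m}} → Odd j → Odd m →
    (T′ : DyadicTriangle) (ι : VertexBijection (hat i j m) T′) (π : Point → ℚ) →
    (∀ p q → π (midpoint p q) ≡ mean (π p) (π q)) → (∀ {p} → Dyadic² p → Dyadic (π p)) →
    IsIsomorphism (hat i j m) T′ ι → ∀ {a b c} →
    π (image (hat i j m) T′ ι 0F) ≡ fromℤ a →
    π (image (hat i j m) T′ ι 1F) ≡ fromℤ b →
    π (image (hat i j m) T′ ι 2F) ≡ fromℤ c →
    ∃₂ λ r s → (+ m) ℤ.* r ≡ c ℤ.- a × (+ j) ℤ.* s ≡ b ℤ.- a ℤ.- i ℤ.* r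
  linear-coordinate i j m odd-j odd-m T′ ι π π-mean π-dyadic (f , f-iso , f-vertex) {a} {b} {c} imA imB imC =
    proj₁ r-int , proj₁ s-int ,
    fromℤ-injective (begin
      fromℤ ((+ m) ℤ.* proj₁ r-int)     ≡⟨ fromℤ-* (+ m) (proj₁ r-int) ⟩
      fromℕ m * fromℤ (proj₁ r-int)       ≡⟨ cong (fromℕ m *_) (proj₂ r-int) ⟨
      fromℕ m * L.r                       ≡⟨ m-r ⟩
      fromℤ (c ℤ.- a)                     ∎) ,
    fromℤ-injective (begin
      fromℤ ((+ j) ℤ.* proj₁ s-int)     ≡⟨ fromℤ-* (+ j) (proj₁ s-int) ⟩
      fromℕ j * fromℤ (proj₁ s-int)       ≡⟨ cong (fromℕ j *_) (proj₂ s-int) ⟨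
      fromℕ j * L.s′                      ≡⟨ j-s ⟩
      fromℤ (b ℤ.- a ℤ.- i ℤ.* proj₁ r-int) ∎)
    where
    open ≡-Reasoning
    T = hat i j m
    open MagmaMorphisms.IsMagmaIsomorphism f-iso using (⟦⟧-cong; homo)

    g : Carrier T → ℚ
    g x = π (proj₁ (f x)) - fromℤ a

    g-cong : ∀ {x y} → proj₁ x ≡ proj₁ y → g x ≡ g y
    g-cong {x} {y} eq = cong (λ p → π p - fromℤ a) (⟦⟧-cong {x} {y} eq)

    g-mean : ∀ x y → g (RawMagma._∙_ (groupoid T) x y) ≡ mean (g x) (g y)
    g-mean x y = trans (cong (_- fromℤ a) (trans (cong π (homo x y)) (π-mean (proj₁ (f x)) (proj₁ (f y)))))
      (solve 3 (λ p q a → con ½ :* (p :+ q) :+ :- a := con ½ :* ((p :+ :- a) :+ (q :+ :- a)))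
        refl (π (proj₁ (f x))) (π (proj₁ (f y))) (fromℤ a))

    g-vertex : ∀ t {z} → π (image T T′ ι t) ≡ fromℤ z → g (vertex∈ T t) ≡ fromℤ (z ℤ.- a)
    g-vertex t {z} eq = trans (cong (_- fromℤ a) (trans (cong π (f-vertex t (vertex∈ T t) refl)) eq))
      (sym (fromℤ-sub z a))

    dominating = dominating-multiple i j
    a₀ = proj₁ dominating
    u  = proj₁ (proj₂ dominating)
    -- The required bound itself serves as exponent, by n ≤ 2ⁿ.
    s  = (j ℕ.+ (m ℕ.+ u)) ℕ.* (m ℕ.+ u ℕ.+ j)

    module L = Additive.Lattice i j m g (λ {x} {y} → g-cong {x} {y}) g-mean
      (trans (g-vertex 0F {a} imA) (cong fromℤ (ℤₚ.+-inverseʳ a)))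
      a₀ u s (proj₂ (proj₂ dominating)) (n≤2^n s)

    g-dyadic : ∀ x → Dyadic (g x)
    g-dyadic x = dyadic-- (π-dyadic (proj₁ (proj₂ (f x)))) (fromℤ-dyadic a)

    m-r : fromℕ m * L.r ≡ fromℤ (c ℤ.- a)
    m-r = trans L.m-r (g-vertex 2F {c} imC)

    r-dyadic : Dyadic L.r
    r-dyadic = dyadic-* (fromℤ-dyadic (+ (2 ℕ.^ s))) (g-dyadic L.e₁)

    r-int : Integral L.r
    r-int = integral-of-odd-multiple m odd-m r-dyadic (c ℤ.- a , m-r)

    j-s : fromℕ j * L.s′ ≡ fromℤ (b ℤ.- a ℤ.- i ℤ.* proj₁ r-int)
    j-s = begin
      fromℕ j * L.s′ ≡⟨ L.j-s′ ⟩
      g (vertex∈ T 1F) - fromℤ i * L.r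
        ≡⟨ cong₂ (λ x y → x - fromℤ i * y) (g-vertex 1F {b} imB) (proj₂ r-int) ⟩
      fromℤ (b ℤ.- a) - fromℤ i * fromℤ (proj₁ r-int)
        ≡⟨ cong (λ x → fromℤ (b ℤ.- a) - x) (fromℤ-* i (proj₁ r-int)) ⟨
      fromℤ (b ℤ.- a) - fromℤ (i ℤ.* proj₁ r-int)
        ≡⟨ fromℤ-sub (b ℤ.- a) (i ℤ.* proj₁ r-int) ⟨
      fromℤ (b ℤ.- a ℤ.- i ℤ.* proj₁ r-int) ∎

    s-int : Integral L.s′
    s-int = integral-of-odd-multiple j odd-j
      (dyadic-- (dyadic-* (fromℤ-dyadic (+ (2 ℕ.^ s))) (g-dyadic L.e₂))
                (dyadic-* (fromℤ-dyadic (+ a₀)) r-dyadic))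
      (b ℤ.- a ℤ.- i ℤ.* proj₁ r-int , j-s)

  -- Vertex permutations and isomorphisms given by affine maps.

  -- Two coinciding vertices would make `cross` vanish.
  vertex-injective : ∀ T {s t} → vertex T s ≡ vertex T t → s ≡ t
  vertex-injective T {s} {t} = distinct s t
    where
    P = vertex T 0F
    Q = vertex T 1F
    R = vertex T 2F
    P≢Q : P ≢ Q
    P≢Q eq = DyadicTriangle.nondegenerate T (trans (cong (λ p → cross p Q R) eq)
      (solve 4 (λ a b c d → (a :+ :- a) :* (d :+ :- b) :+ :- ((c :+ :- a) :* (b :+ :- b)) := con 0ℚ)
        refl (proj₁ Q) (proj₂ Q) (proj₁ R) (proj₂ R)))
    P≢R : P ≢ R
    P≢R eq = DyadicTriangle.nondegenerate T (trans (cong (λ p → cross p Q R) eq)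
      (solve 4 (λ a b c d → (a :+ :- c) :* (d :+ :- d) :+ :- ((c :+ :- c) :* (b :+ :- d)) := con 0ℚ)
        refl (proj₁ Q) (proj₂ Q) (proj₁ R) (proj₂ R)))
    Q≢R : Q ≢ R
    Q≢R eq = DyadicTriangle.nondegenerate T (trans (cong (λ p → cross P p R) eq)
      (solve 4 (λ a b c d → (c :+ :- a) :* (d :+ :- b) :+ :- ((c :+ :- a) :* (d :+ :- b)) := con 0ℚ)
        refl (proj₁ P) (proj₂ P) (proj₁ R) (proj₂ R)))
    distinct : ∀ s t → vertex T s ≡ vertex T t → s ≡ t
    distinct 0F 0F _  = refl
    distinct 0F 1F eq = ⊥-elim (P≢Q eq)
    distinct 0F 2F eq = ⊥-elim (P≢R eq)
    distinct 1F 0F eq = ⊥-elim (P≢Q (sym eq))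
    distinct 1F 1F _  = refl
    distinct 1F 2F eq = ⊥-elim (Q≢R eq)
    distinct 2F 0F eq = ⊥-elim (P≢R (sym eq))
    distinct 2F 1F eq = ⊥-elim (Q≢R (sym eq))
    distinct 2F 2F _  = refl

  -- An affine map delivers the vertices of the target in the order prescribed by the vertex
  -- bijection; this lemma forgets that order by moving the weights along the inverse permutation.
  hull-permute : ∀ {n} (v : Vector Point n) (σ : Permutation′ n) {p} →
                 Hull (v ∘ (σ ⟨$⟩ʳ_)) p → Hull v p
  hull-permute v σ (w , w≥0 , ∑w , eq) =
    w ∘ (σ ⟨$⟩ˡ_) , (λ r → w≥0 (σ ⟨$⟩ˡ r)) , trans (sym (sum-permute w (Perm.flip σ))) ∑w ,
    trans eq (cong₂ _,_ (coordinate proj₁) (coordinate proj₂))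
    where
    coordinate : (π : Point → ℚ) → sum (λ t → w t * π (v (σ ⟨$⟩ʳ t))) ≡ sum (λ r → w (σ ⟨$⟩ˡ r) * π (v r))
    coordinate π = sym (trans (sum-permute (λ r → w (σ ⟨$⟩ˡ r) * π (v r)) σ)
      (sum-cong-≗ (λ t → cong (λ k → w k * π (v (σ ⟨$⟩ʳ t))) (Perm.inverseˡ σ))))

  record AffineForm : Set where
    constructor affine
    field
      constant x-coeff y-coeff : ℚ

    _at_ : Point → ℚ
    _at_ (x , y) = constant + x * x-coeff + y * y-coeff

  open AffineForm using (_at_)

  IsDyadicForm : AffineForm → Set
  IsDyadicForm (affine v a c) = Dyadic v × Dyadic a × Dyadic c

  at-dyadic : ∀ {φ} → IsDyadicForm φ → ∀ {p} → Dyadic² p → Dyadic (φ at p)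
  at-dyadic (dv , da , dc) (dx , dy) = dyadic-+ (dyadic-+ dv (dyadic-* dx da)) (dyadic-* dy dc)

  at-mean : ∀ φ p q → φ at (midpoint p q) ≡ mean (φ at p) (φ at q)
  at-mean (affine v a c) (x , y) (x′ , y′) =
    solve 7 (λ v a c x y x′ y′ →
      v :+ con ½ :* (x :+ x′) :* a :+ con ½ :* (y :+ y′) :* c
      := con ½ :* ((v :+ x :* a :+ y :* c) :+ (v :+ x′ :* a :+ y′ :* c)))
      refl v a c x y x′ y′

  -- The weights sum to 1, which lets the constant term be distributed over the summands.
  at-combination : ∀ φ (w : Vector ℚ 3) → sum w ≡ 1ℚ → (u : Vector Point 3) →
    φ at combination w u ≡ sum (λ t → w t * (φ at u t))
  at-combination (affine v a c) w ∑w u = balance (cong (v *_) (sym ∑w))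
    (solve 12 (λ v a c p q r x x′ x″ y y′ y″ →
      v :+ (p :* x :+ (q :* x′ :+ (r :* x″ :+ con 0ℚ))) :* a :+ (p :* y :+ (q :* y′ :+ (r :* y″ :+ con 0ℚ))) :* c
        :+ v :* (p :+ (q :+ (r :+ con 0ℚ)))
      := (p :* (v :+ x :* a :+ y :* c) :+ (q :* (v :+ x′ :* a :+ y′ :* c) :+ (r :* (v :+ x″ :* a :+ y″ :* c) :+ con 0ℚ)))
        :+ v :* con 1ℚ)
      refl v a c (w 0F) (w 1F) (w 2F) (proj₁ (u 0F)) (proj₁ (u 1F)) (proj₁ (u 2F))
        (proj₂ (u 0F)) (proj₂ (u 1F)) (proj₂ (u 2F)))

  ⟪_,_⟫ : AffineForm → AffineForm → Point → Point
  ⟪ φ , ψ ⟫ p = φ at p , ψ at p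

  affine-hull : ∀ φ ψ {v u : Vector Point 3} → (∀ t → ⟪ φ , ψ ⟫ (v t) ≡ u t) →
    ∀ {p} → Hull v p → Hull u (⟪ φ , ψ ⟫ p)
  affine-hull φ ψ {v} {u} vu (w , w≥0 , ∑w , refl) = w , w≥0 , ∑w , cong₂ _,_
    (trans (at-combination φ w ∑w v) (sum-cong-≗ (λ t → cong (λ p → w t * proj₁ p) (vu t))))
    (trans (at-combination ψ w ∑w v) (sum-cong-≗ (λ t → cong (λ p → w t * proj₂ p) (vu t))))

  module _ (T T′ : DyadicTriangle) (ι : VertexBijection T T′) where

    private
      index : Fin 3 → Fin 3
      index t = proj₁ (proj₂ (Bijection.to ι (vertexAt T t)))

      image-index : ∀ t → image T T′ ι t ≡ vertex T′ (index t)
      image-index t = proj₂ (proj₂ (Bijection.to ι (vertexAt T t)))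

      coindex : Fin 3 → Fin 3
      coindex r = proj₁ (proj₂ (proj₁ (Bijection.surjective ι (vertexAt T′ r))))

    image-injective : ∀ {s t} → image T T′ ι s ≡ image T T′ ι t → s ≡ t
    image-injective eq = vertex-injective T (Bijection.injective ι eq)

    private
      image-coindex : ∀ r → image T T′ ι (coindex r) ≡ vertex T′ r
      image-coindex r with Bijection.surjective ι (vertexAt T′ r)
      ... | (p , t , p≡) , to≈ = to≈ {vertexAt T t} (sym p≡)

    vertexPermutation : Permutation′ 3
    vertexPermutation = permutation index coindex
      (λ r → vertex-injective T′ (trans (sym (image-index (coindex r))) (image-coindex r)))
      (λ t → image-injective (trans (image-coindex (index t)) (sym (image-index t))))

    image-vertex : ∀ t → image T T′ ι t ≡ vertex T′ (vertexPermutation ⟨$⟩ʳ t)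
    image-vertex = image-index

    -- Knowing the map at the vertices suffices: it carries hull into hull, and its inverse, which
    -- permutes the vertices back, does the same in the other direction. Dyadic coefficients on both
    -- sides keep dyadic points dyadic.
    affine-isomorphism : ∀ {φ ψ φ′ ψ′} →
      IsDyadicForm φ → IsDyadicForm ψ → IsDyadicForm φ′ → IsDyadicForm ψ′ →
      (∀ p → ⟪ φ′ , ψ′ ⟫ (⟪ φ , ψ ⟫ p) ≡ p) → (∀ p → ⟪ φ , ψ ⟫ (⟪ φ′ , ψ′ ⟫ p) ≡ p) →
      (∀ t → ⟪ φ , ψ ⟫ (vertex T t) ≡ image T T′ ι t) → IsIsomorphism T T′ ι
    affine-isomorphism {φ} {ψ} {φ′} {ψ′} dφ dψ dφ′ dψ′ GF FG F-vertex =
      f , record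
        { isMagmaMonomorphism = record
          { isMagmaHomomorphism = record
            { isRelHomomorphism = record { cong = cong F }
            ; homo = λ (p , _) (q , _) → cong₂ _,_ (at-mean φ p q) (at-mean ψ p q)
            }
          ; injective = λ {(p , _)} {(q , _)} Fp≡Fq → trans (sym (GF p)) (trans (cong G Fp≡Fq) (GF q))
          }
        ; surjective = λ { (q , dq , hq) →
            (G q , (at-dyadic dφ′ dq , at-dyadic dψ′ dq) , G-hull hq) ,
            λ p≡Gq → trans (cong F p≡Gq) (FG q) }
        } ,
      λ t x x≡vertex → trans (cong F x≡vertex) (F-vertex t)
      where
      F = ⟪ φ , ψ ⟫
      G = ⟪ φ′ , ψ′ ⟫
      σ = vertexPermutation

      F-hull : ∀ {p} → Hull (vertex T) p → Hull (vertex T′) (F p)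
      F-hull = hull-permute (vertex T′) σ ∘ affine-hull φ ψ {vertex T} (λ t → trans (F-vertex t) (image-vertex t))

      G-hull : ∀ {q} → Hull (vertex T′) q → Hull (vertex T) (G q)
      G-hull = hull-permute (vertex T) (Perm.flip σ) ∘ affine-hull φ′ ψ′ {vertex T′} (λ r →
        trans (cong G (sym (trans (F-vertex (σ ⟨$⟩ˡ r)) (trans (image-vertex (σ ⟨$⟩ˡ r))
                (cong (vertex T′) (Perm.inverseʳ σ))))))
              (GF (vertex T (σ ⟨$⟩ˡ r))))

      f : Carrier T → Carrier T′
      f (p , dp , hp) = F p , (at-dyadic dφ dp , at-dyadic dψ dp) , F-hull hp

  sub-+-cancel : ∀ {p q r : ℚ} → r ≡ p - q → q + r ≡ p
  sub-+-cancel {p} {q} refl = solve 2 (λ p q → q :+ (p :+ :- q) := p) refl p q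

  -- From `δ * δ ≡ 1ℤ` the determinant is its own inverse, so δ times the adjugate is an integral
  -- inverse matrix obtained without division, for either orientation at once. The constants of `φ′`
  -- and `ψ′` are the image of the negated translation under it.
  matrix-isomorphism : ∀ i j m .{{_ : ℕ.NonZero j}} .{{_ : ℕ.NonZero m}} →
    (T′ : DyadicTriangle) (ι : VertexBijection (hat i j m) T′) → ∀ {x x′ y y′ z z′} →
    image (hat i j m) T′ ι 0F ≡ (fromℤ x , fromℤ x′) →
    image (hat i j m) T′ ι 1F ≡ (fromℤ y , fromℤ y′) →
    image (hat i j m) T′ ι 2F ≡ (fromℤ z , fromℤ z′) → ∀ r r′ s s′ δ →
    (+ m) ℤ.* r ≡ z ℤ.- x → (+ m) ℤ.* r′ ≡ z′ ℤ.- x′ →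
    (+ j) ℤ.* s ≡ y ℤ.- x ℤ.- i ℤ.* r → (+ j) ℤ.* s′ ≡ y′ ℤ.- x′ ℤ.- i ℤ.* r′ →
    r ℤ.* s′ ℤ.- r′ ℤ.* s ≡ δ → δ ℤ.* δ ≡ 1ℤ →
    IsIsomorphism (hat i j m) T′ ι
  matrix-isomorphism i j m T′ ι {x} {x′} {y} {y′} {z} {z′} imA imB imC r r′ s s′ δ mr mr′ js js′ det δδ =
    affine-isomorphism T T′ ι {φ} {ψ} {φ′} {ψ′}
      (int x , int r , int s) (int x′ , int r′ , int s′)
      (dyadic-* (int δ) (dyadic-- (dyadic-* (int x′) (int s)) (dyadic-* (int x) (int s′))) ,
       dyadic-* (int δ) (int s′) , dyadic-neg (dyadic-* (int δ) (int s)))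
      (dyadic-* (int δ) (dyadic-- (dyadic-* (int x) (int r′)) (dyadic-* (int x′) (int r))) ,
       dyadic-neg (dyadic-* (int δ) (int r′)) , dyadic-* (int δ) (int r))
      (λ (p , q) → cong₂ _,_
        (balance (cong₂ _+_ (cong (λ d → D * p * d) det-ℚ) (cong (p *_) δδ-ℚ))
          (solve 9 (λ X X′ R R′ S S′ D p q →
             (D :* (X′ :* S :- X :* S′) :+ (X :+ p :* R :+ q :* S) :* (D :* S′) :+ (X′ :+ p :* R′ :+ q :* S′) :* (:- (D :* S)))
               :+ (D :* p :* D :+ p :* con 1ℚ)
             := p :+ (D :* p :* (R :* S′ :- R′ :* S) :+ p :* (D :* D)))
            refl X X′ R R′ S S′ D p q))
        (balance (cong₂ _+_ (cong (λ d → D * q * d) det-ℚ) (cong (q *_) δδ-ℚ))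
          (solve 9 (λ X X′ R R′ S S′ D p q →
             (D :* (X :* R′ :- X′ :* R) :+ (X :+ p :* R :+ q :* S) :* (:- (D :* R′)) :+ (X′ :+ p :* R′ :+ q :* S′) :* (D :* R))
               :+ (D :* q :* D :+ q :* con 1ℚ)
             := q :+ (D :* q :* (R :* S′ :- R′ :* S) :+ q :* (D :* D)))
            refl X X′ R R′ S S′ D p q)))
      (λ (p , q) → cong₂ _,_
        (balance (cong₂ _+_ (cong (λ d → D * (p - X) * d) det-ℚ) (cong ((p - X) *_) δδ-ℚ))
          (solve 9 (λ X X′ R R′ S S′ D p q →
             (X :+ (D :* (X′ :* S :- X :* S′) :+ p :* (D :* S′) :+ q :* (:- (D :* S))) :* R
                :+ (D :* (X :* R′ :- X′ :* R) :+ p :* (:- (D :* R′)) :+ q :* (D :* R)) :* S)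
               :+ (D :* (p :- X) :* D :+ (p :- X) :* con 1ℚ)
             := p :+ (D :* (p :- X) :* (R :* S′ :- R′ :* S) :+ (p :- X) :* (D :* D)))
            refl X X′ R R′ S S′ D p q))
        (balance (cong₂ _+_ (cong (λ d → D * (q - X′) * d) det-ℚ) (cong ((q - X′) *_) δδ-ℚ))
          (solve 9 (λ X X′ R R′ S S′ D p q →
             (X′ :+ (D :* (X′ :* S :- X :* S′) :+ p :* (D :* S′) :+ q :* (:- (D :* S))) :* R′
                :+ (D :* (X :* R′ :- X′ :* R) :+ p :* (:- (D :* R′)) :+ q :* (D :* R)) :* S′)
               :+ (D :* (q :- X′) :* D :+ (q :- X′) :* con 1ℚ)
             := q :+ (D :* (q :- X′) :* (R :* S′ :- R′ :* S) :+ (q :- X′) :* (D :* D)))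
            refl X X′ R R′ S S′ D p q)))
      (λ { 0F → trans (cong₂ _,_ (at-A X R S) (at-A X′ R′ S′)) (sym imA)
         ; 1F → trans (cong₂ _,_ (at-B x y r s js) (at-B x′ y′ r′ s′ js′)) (sym imB)
         ; 2F → trans (cong₂ _,_ (at-C x z r s mr) (at-C x′ z′ r′ s′ mr′)) (sym imC) })
    where
    T = hat i j m
    X  = fromℤ x
    X′ = fromℤ x′
    R  = fromℤ r
    R′ = fromℤ r′
    S  = fromℤ s
    S′ = fromℤ s′
    D  = fromℤ δ
    φ  = affine X R S
    ψ  = affine X′ R′ S′
    φ′ = affine (D * (X′ * S - X * S′)) (D * S′) (- (D * S))
    ψ′ = affine (D * (X * R′ - X′ * R)) (- (D * R′)) (D * R)

    int = fromℤ-dyadic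

    det-ℚ : R * S′ - R′ * S ≡ D
    det-ℚ = trans (sym (trans (fromℤ-sub (r ℤ.* s′) (r′ ℤ.* s)) (cong₂ _-_ (fromℤ-* r s′) (fromℤ-* r′ s))))
      (cong fromℤ det)

    δδ-ℚ : D * D ≡ 1ℚ
    δδ-ℚ = trans (sym (fromℤ-* δ δ)) (cong fromℤ δδ)

    at-A : ∀ v a c → v + 0ℚ * a + 0ℚ * c ≡ v
    at-A = solve 3 (λ v a c → v :+ con 0ℚ :* a :+ con 0ℚ :* c := v) refl

    at-B : ∀ x y r s → (+ j) ℤ.* s ≡ y ℤ.- x ℤ.- i ℤ.* r →
      fromℤ x + fromℤ i * fromℤ r + fromℕ j * fromℤ s ≡ fromℤ y
    at-B x y r s eq = balance
      (trans (sym (fromℤ-* (+ j) s)) (trans (cong fromℤ eq)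
        (trans (fromℤ-sub (y ℤ.- x) (i ℤ.* r)) (cong₂ _-_ (fromℤ-sub y x) (fromℤ-* i r)))))
      (solve 4 (λ x y ir js → (x :+ ir :+ js) :+ ((y :- x) :- ir) := y :+ js) refl
        (fromℤ x) (fromℤ y) (fromℤ i * fromℤ r) (fromℕ j * fromℤ s))

    at-C : ∀ x z r s → (+ m) ℤ.* r ≡ z ℤ.- x →
      fromℤ x + fromℕ m * fromℤ r + 0ℚ * fromℤ s ≡ fromℤ z
    at-C x z r s eq = trans
      (solve 4 (λ x m r s → x :+ m :* r :+ con 0ℚ :* s := x :+ m :* r) refl (fromℤ x) (fromℕ m) (fromℤ r) (fromℤ s))
      (sub-+-cancel (trans (sym (fromℤ-* (+ m) r)) (trans (cong fromℤ eq) (fromℤ-sub z x))))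

  -- Areas of hats.

  hat-area : ∀ i j m .{{_ : ℕ.NonZero j}} .{{_ : ℕ.NonZero m}} →
    fromℕ 2 * area (hat i j m) ≡ fromℕ (m ℕ.* j)
  hat-area i j m = begin
    fromℕ 2 * (½ * ∣ crossT ∣)
      ≡⟨ solve 1 (λ a → con (fromℕ 2) :* (con ½ :* a) := a) refl ∣ crossT ∣ ⟩
    ∣ crossT ∣
      ≡⟨ cong ∣_∣ (trans (solve 3 (λ i j m →
           (i :+ :- con 0ℚ) :* (con 0ℚ :+ :- con 0ℚ) :+ :- ((m :+ :- con 0ℚ) :* (j :+ :- con 0ℚ)) := :- (m :* j))
           refl (fromℤ i) (fromℕ j) (fromℕ m)) (cong -_ (sym (fromℕ-* m j)))) ⟩
    ∣ - fromℕ (m ℕ.* j) ∣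
      ≡⟨ ∣-p∣≡∣p∣ (fromℕ (m ℕ.* j)) ⟩
    ∣ fromℕ (m ℕ.* j) ∣
      ≡⟨ 0≤p⇒∣p∣≡p (fromℕ-nonNeg (m ℕ.* j)) ⟩
    fromℕ (m ℕ.* j) ∎
    where
    open ≡-Reasoning
    crossT = cross (vertex (hat i j m) 0F) (vertex (hat i j m) 1F) (vertex (hat i j m) 2F)

  equal-area : ∀ i j m k l n .{{_ : ℕ.NonZero j}} .{{_ : ℕ.NonZero m}} .{{_ : ℕ.NonZero l}} .{{_ : ℕ.NonZero n}} →
    area (hat i j m) ≡ area (hat k l n) → m ℕ.* j ≡ n ℕ.* l
  equal-area i j m k l n eq = ℤₚ.+-injective (fromℤ-injective
    (trans (sym (hat-area i j m)) (trans (cong (λ x → fromℕ 2 * x) eq) (hat-area k l n))))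

open Geometry using
  ( ≡-/; fromℤ-injective; fromℕ-*
  ; vertexPermutation; image-injective; image-vertex; linear-coordinate; matrix-isomorphism; equal-area )

open import Algebra.Properties.AbelianGroup ℤₚ.+-0-abelianGroup using (∙-cancelʳ)
open import Data.Integer.Base using (+_; _+_; _-_; _*_; -_)
open import Data.Integer.Divisibility using (_∣_)
open import Data.Integer.GCD using (gcd; gcd[i,j]∣i; gcd[i,j]∣j; gcd-greatest)
open import Data.Integer.Solver using (module +-*-Solver)
open import Data.Rational.Base using (_/_)
open +-*-Solver using (solve; _:=_; _:+_; _:*_; _:-_; :-_; con)

-- Divisibility and greatest common divisors.

balanceℤ : ∀ {p q u v : ℤ} → u ≡ v → p + v ≡ q + u → p ≡ q
balanceℤ {v = v} refl = ∙-cancelʳ v _ _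

-- Used when base goes to base. With `l = q j` the area equation becomes m = q n, so n divides m as
-- well as being divided by it; then l = j follows by cancelling m.
squeeze : ∀ {j m l n} .{{_ : ℕ.NonZero j}} .{{_ : ℕ.NonZero m}} →
  m ℕ.∣ n → j ℕ.∣ l → m ℕ.* j ≡ n ℕ.* l → l ≡ j × n ≡ m
squeeze {j} {m} {l} {n} m∣n (ℕ.divides q l≡qj) mj≡nl =
  ℕₚ.*-cancelˡ-≡ l j m (trans (cong (ℕ._* l) (sym n≡m)) (sym mj≡nl)) , n≡m
  where
  n∣m : n ℕ.∣ m
  n∣m = ℕ.divides q (ℕₚ.*-cancelʳ-≡ m (q ℕ.* n) j (trans mj≡nl (trans (cong (n ℕ.*_) l≡qj)
    (trans (sym (ℕₚ.*-assoc n q j)) (cong (ℕ._* j) (ℕₚ.*-comm n q))))))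
  n≡m : n ≡ m
  n≡m = ℕ.∣-antisym n∣m m∣n

divides-ℕ : ∀ m {n r} → + m * r ≡ + n → m ℕ.∣ n
divides-ℕ m {n} {r} eq = ∣⇒∣ᵤ {+ m} {+ n} (divides r (trans (sym eq) (ℤₚ.*-comm (+ m) r)))

module _ {j m l n : ℕ} .{{_ : ℕ.NonZero j}} .{{_ : ℕ.NonZero m}} .{{_ : ℕ.NonZero n}}
  (mj≡nl : m ℕ.* j ≡ n ℕ.* l) where

  private
    mj≡nlℤ : + m * + j ≡ + n * + l
    mj≡nlℤ = trans (sym (ℤₚ.pos-* m j)) (trans (cong +_ mj≡nl) (ℤₚ.pos-* n l))

  l≡mj/n : fromℕ l ≡ + (m ℕ.* j) / n
  l≡mj/n = ≡-/ n (+ (m ℕ.* j)) (trans (sym (fromℕ-* n l)) (cong fromℕ (sym mj≡nl)))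

  -- Cancelling m in m j = n l = n m b gives j = n b, and cancelling j in j e = n b e = n j t gives
  -- e = n t; so n is a common divisor. Conversely the gcd divides the combination a e - j q = n.
  gcd-necessary : ∀ {e a b q t} → + l ≡ + m * b → a * e - + n ≡ + j * q → b * e ≡ + j * t →
    + n ≡ gcd e (+ j) × fromℕ l ≡ + (m ℕ.* j) / n × + j ∣ a * e - + n
  gcd-necessary {e} {a} {b} {q} {t} l≡mb ae-n be =
    cong +_ (ℕ.∣-antisym
      (gcd-greatest {e} {+ j} {+ n} (∣⇒∣ᵤ (divides t (trans e≡nt (ℤₚ.*-comm (+ n) t))))
                                    (∣⇒∣ᵤ (divides b (trans j≡nb (ℤₚ.*-comm (+ n) b)))))
      (∣⇒∣ᵤ (subst (gcd e (+ j) Signed.∣_) (sym n≡ae-jq)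
        (Signed.∣m∣n⇒∣m-n (Signed.∣n⇒∣m*n a (∣ᵤ⇒∣ {gcd e (+ j)} {e} (gcd[i,j]∣i e (+ j))))
                          (Signed.∣m⇒∣m*n q (∣ᵤ⇒∣ {gcd e (+ j)} {+ j} (gcd[i,j]∣j e (+ j)))))))) ,
    l≡mj/n ,
    ∣⇒∣ᵤ (divides q (trans ae-n (ℤₚ.*-comm (+ j) q)))
    where
    j≡nb : + j ≡ + n * b
    j≡nb = ℤₚ.*-cancelˡ-≡ (+ m) (+ j) (+ n * b) (trans mj≡nlℤ (trans (cong (+ n *_) l≡mb)
      (solve 3 (λ n m b → n :* (m :* b) := m :* (n :* b)) refl (+ n) (+ m) b)))
    e≡nt : e ≡ + n * t
    e≡nt = ℤₚ.*-cancelˡ-≡ (+ j) e (+ n * t) (trans (cong (_* e) j≡nb)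
      (trans (ℤₚ.*-assoc (+ n) b e) (trans (cong (+ n *_) be)
      (solve 3 (λ n j t → n :* (j :* t) := j :* (n :* t)) refl (+ n) (+ j) t))))
    n≡ae-jq : + n ≡ a * e - + j * q
    n≡ae-jq = balanceℤ (sym ae-n)
      (solve 3 (λ n x y → n :+ (x :- n) := (x :- y) :+ y) refl (+ n) (a * e) (+ j * q))

  -- a t - b q is, up to sign, the determinant of the matrix of the isomorphism.
  gcd-sufficient : ∀ {e a} → + n ≡ gcd e (+ j) → + j ∣ a * e - + n →
    ∃ λ b → ∃₂ λ q t → + l ≡ + m * b × a * e - + n ≡ + j * q × b * e ≡ + j * t × a * t - b * q ≡ 1ℤ
  gcd-sufficient {e} {a} n≡gcd j∣ae-n
    with ∣ᵤ⇒∣ {+ n} {e} (subst (_∣ e) (sym n≡gcd) (gcd[i,j]∣i e (+ j)))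
       | ∣ᵤ⇒∣ {+ n} {+ j} (subst (_∣ + j) (sym n≡gcd) (gcd[i,j]∣j e (+ j)))
       | ∣ᵤ⇒∣ {+ j} {a * e - + n} j∣ae-n
  ... | divides t e≡tn | divides b j≡bn | divides q ae-n =
    b , q , t ,
    ℤₚ.*-cancelˡ-≡ (+ n) (+ l) (+ m * b) (trans (sym mj≡nlℤ) (trans (cong (+ m *_) j≡bn)
      (solve 3 (λ n m b → m :* (b :* n) := n :* (m :* b)) refl (+ n) (+ m) b))) ,
    trans ae-n (ℤₚ.*-comm q (+ j)) ,
    trans (cong (b *_) e≡tn) (trans
      (solve 3 (λ b t n → b :* (t :* n) := b :* n :* t) refl b t (+ n)) (cong (_* t) (sym j≡bn))) ,
    ℤₚ.*-cancelˡ-≡ (+ n) (a * t - b * q) 1ℤ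
      (balanceℤ (cong₂ _+_ ae-n (cong₂ (λ j e → q * j - a * e) j≡bn e≡tn))
        (solve 7 (λ n a t b q j e →
            n :* (a :* t :- b :* q) :+ (q :* j :+ (q :* (b :* n) :- a :* (t :* n)))
            := n :* con 1ℤ :+ ((a :* e :- n) :+ (q :* j :- a :* e)))
          refl (+ n) a t b q (+ j) e))

-- The six possible arrangements of the vertices.

six-kinds : ∀ T T′ (ι : VertexBijection T T′) →
  let A′ = image T T′ ι 0F
      B′ = image T T′ ι 1F
      C′ = image T T′ ι 2F
      ABC→XYZ = ABC→ T T′ ι
  in
  ABC→XYZ A′ B′ C′ ⊎ ABC→XYZ C′ B′ A′ ⊎ ABC→XYZ A′ C′ B′ ⊎
  ABC→XYZ C′ A′ B′ ⊎ ABC→XYZ B′ C′ A′ ⊎ ABC→XYZ B′ A′ C′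
six-kinds T T′ ι =
  kinds (σ ⟨$⟩ʳ 0F) (σ ⟨$⟩ʳ 1F) (σ ⟨$⟩ʳ 2F)
    (image-vertex T T′ ι 0F) (image-vertex T T′ ι 1F) (image-vertex T T′ ι 2F)
  where
  σ  = vertexPermutation T T′ ι
  im = image T T′ ι
  A′ = im 0F
  B′ = im 1F
  C′ = im 2F
  ABC→XYZ = ABC→ T T′ ι
  clash : ∀ {s t r} {P : Set} → s ≢ t → im s ≡ vertex T′ r → im t ≡ vertex T′ r → P
  clash s≢t p q = ⊥-elim (s≢t (image-injective T T′ ι (trans p (sym q))))
  kinds : ∀ x y z → im 0F ≡ vertex T′ x → im 1F ≡ vertex T′ y → im 2F ≡ vertex T′ z →
    ABC→XYZ A′ B′ C′ ⊎ ABC→XYZ C′ B′ A′ ⊎ ABC→XYZ A′ C′ B′ ⊎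
    ABC→XYZ C′ A′ B′ ⊎ ABC→XYZ B′ C′ A′ ⊎ ABC→XYZ B′ A′ C′
  kinds 0F 0F _  a b c = clash (λ ()) a b
  kinds 1F 1F _  a b c = clash (λ ()) a b
  kinds 2F 2F _  a b c = clash (λ ()) a b
  kinds 0F 1F 0F a b c = clash (λ ()) a c
  kinds 0F 1F 1F a b c = clash (λ ()) b c
  kinds 0F 1F 2F a b c = inj₁ (a , b , c)
  kinds 0F 2F 0F a b c = clash (λ ()) a c
  kinds 0F 2F 1F a b c = inj₂ (inj₂ (inj₁ (a , c , b)))
  kinds 0F 2F 2F a b c = clash (λ ()) b c
  kinds 1F 0F 0F a b c = clash (λ ()) b c
  kinds 1F 0F 1F a b c = clash (λ ()) a c
  kinds 1F 0F 2F a b c = inj₂ (inj₂ (inj₂ (inj₂ (inj₂ (b , a , c)))))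
  -- The word XYZ lists images in the order of the vertices of T′, so it spells the inverse of the
  -- index permutation. This matters only for the two 3-cycles.
  kinds 1F 2F 0F a b c = inj₂ (inj₂ (inj₂ (inj₁ (c , a , b))))
  kinds 1F 2F 1F a b c = clash (λ ()) a c
  kinds 1F 2F 2F a b c = clash (λ ()) b c
  kinds 2F 0F 0F a b c = clash (λ ()) b c
  kinds 2F 0F 1F a b c = inj₂ (inj₂ (inj₂ (inj₂ (inj₁ (b , c , a)))))
  kinds 2F 0F 2F a b c = clash (λ ()) a c
  kinds 2F 1F 0F a b c = inj₂ (inj₁ (c , b , a))
  kinds 2F 1F 1F a b c = clash (λ ()) b c
  kinds 2F 1F 2F a b c = clash (λ ()) a c

-- Integer identities relating the matrix rows to the criteria.

det : ℤ × ℤ → ℤ × ℤ → ℤ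
det (r , r′) (s , s′) = r * s′ - r′ * s

-- r and s are the rows of a matrix which, followed by a translation, takes
-- (0,0), (i,J), (M,0) to P, Q, R.
Rows : (J M i : ℤ) (P Q R r s : ℤ × ℤ) → Set
Rows J M i (x , x′) (y , y′) (z , z′) (r , r′) (s , s′) =
  M * r ≡ z - x × M * r′ ≡ z′ - x′ × J * s ≡ y - x - i * r × J * s′ ≡ y′ - x′ - i * r′

-- Up to the signs of the entries, `(a , b)` and `(q , t)` are the two rows of the matrix. One
-- system covers four arrangements: exchanging A and C in T replaces i by m - i, which is the choice
-- of `e`, and exchanging the ends of the base of T′ replaces k by n - k, which shows only in the
-- formula for `k`.
GcdSystem : (J M L N e a b q t : ℤ) → Set
GcdSystem J M L N e a b q t = L ≡ M * b × a * e - N ≡ J * q × b * e ≡ J * t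

-- The integer identities are proved for variables J, M, L, N, since terms such
-- as + j + + l would be evaluated by the type checker.
module _ {i k J M L N : ℤ} where

  height : ∀ {r′ s′} → r′ ≡ 0ℤ → J * s′ ≡ L - 0ℤ - i * r′ → J * s′ ≡ L
  height {s′ = s′} refl eq = balanceℤ eq
    (solve 3 (λ i L js → js :+ (L :- con 0ℤ :- i :* con 0ℤ) := L :+ js) refl i L (J * s′))

  abscissa-a : ∀ {r s} → r ≡ 1ℤ → J * s ≡ k - 0ℤ - i * r → k ≡ i + J * s
  abscissa-a {s = s} refl eq = balanceℤ (sym eq)
    (solve 3 (λ i k js → k :+ js := (i :+ js) :+ (k :- con 0ℤ :- i :* con 1ℤ)) refl i k (J * s))

  -- The matrix is a horizontal shear, fixing the line through the base pointwise.
  rows-a : ∀ {p} → L ≡ J → N ≡ M → k ≡ i + J * p →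
    Rows J M i (0ℤ , 0ℤ) (k , L) (N , 0ℤ) (1ℤ , 0ℤ) (p , 1ℤ)
  rows-a {p} refl refl refl =
    solve 1 (λ M → M :* con 1ℤ := M :- con 0ℤ) refl M ,
    ℤₚ.*-zeroʳ M ,
    solve 2 (λ i Jp → Jp := i :+ Jp :- con 0ℤ :- i :* con 1ℤ) refl i (J * p) ,
    solve 2 (λ i J → J :* con 1ℤ := J :- con 0ℤ :- i :* con 0ℤ) refl i J

  abscissa-b : ∀ {r s} → N ≡ M → r ≡ -1ℤ → J * s ≡ k - N - i * r → k ≡ M - i + J * s
  abscissa-b {s = s} refl refl eq = balanceℤ (sym eq)
    (solve 4 (λ i k js M → k :+ js := (M :- i :+ js) :+ (k :- M :- i :* con -1ℤ)) refl i k (J * s) M)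

  -- As the base is reversed, the matrix combines a horizontal shear with the sign change of the
  -- first coordinate.
  rows-b : ∀ {p} → L ≡ J → N ≡ M → k ≡ M - i + J * p →
    Rows J M i (N , 0ℤ) (k , L) (0ℤ , 0ℤ) (-1ℤ , 0ℤ) (p , 1ℤ)
  rows-b {p} refl refl refl =
    solve 1 (λ M → M :* con -1ℤ := con 0ℤ :- M) refl M ,
    ℤₚ.*-zeroʳ M ,
    solve 3 (λ i Jp M → Jp := M :- i :+ Jp :- M :- i :* con -1ℤ) refl i (J * p) M ,
    solve 2 (λ i J → J :* con 1ℤ := J :- con 0ℤ :- i :* con 0ℤ) refl i J

  rows⇒gcd-c : ∀ {r r′ s s′} → Rows J M i (0ℤ , 0ℤ) (N , 0ℤ) (k , L) (r , r′) (s , s′) →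
    GcdSystem J M L N i r r′ (- s) (- s′) × k ≡ r * M
  rows⇒gcd-c {r} {r′} {s} {s′} (mr , mr′ , js , js′) =
    (balanceℤ (sym mr′) (solve 2 (λ l mr → l :+ mr := mr :+ (l :- con 0ℤ)) refl L (M * r′)) ,
     balanceℤ js (solve 5 (λ r i n j s → r :* i :- n :+ (n :- con 0ℤ :- i :* r) := j :* (:- s) :+ j :* s) refl r i N J s) ,
     balanceℤ js′ (solve 4 (λ r i j s → r :* i :+ (con 0ℤ :- con 0ℤ :- i :* r) := j :* (:- s) :+ j :* s) refl r′ i J s′)) ,
    balanceℤ (sym mr) (solve 3 (λ k m r → k :+ m :* r := r :* m :+ (k :- con 0ℤ)) refl k M r)

  gcd⇒rows-c : ∀ {a b q t} → GcdSystem J M L N i a b q t → k ≡ a * M → a * t - b * q ≡ 1ℤ →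
    Rows J M i (0ℤ , 0ℤ) (N , 0ℤ) (k , L) (a , b) (- q , - t) × det (a , b) (- q , - t) ≡ -1ℤ
  gcd⇒rows-c {a} {b} {q} {t} (l≡ , ae-n , be) k≡ det≡ =
    (balanceℤ (sym k≡) (solve 3 (λ m a k → m :* a :+ k := k :- con 0ℤ :+ a :* m) refl M a k) ,
     balanceℤ (sym l≡) (solve 3 (λ m b l → m :* b :+ l := l :- con 0ℤ :+ m :* b) refl M b L) ,
     balanceℤ ae-n (solve 5 (λ j q a e n → j :* (:- q) :+ j :* q := n :- con 0ℤ :- e :* a :+ (a :* e :- n)) refl J q a i N) ,
     balanceℤ be (solve 4 (λ j t b e → j :* (:- t) :+ j :* t := con 0ℤ :- con 0ℤ :- e :* b :+ b :* e) refl J t b i)) ,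
    balanceℤ (sym det≡) (solve 4 (λ a b q t → a :* (:- t) :- b :* (:- q) :+ (a :* t :- b :* q) := con -1ℤ :+ con 1ℤ) refl a b q t)

  rows⇒gcd-d : ∀ {r r′ s s′} → Rows J M i (k , L) (N , 0ℤ) (0ℤ , 0ℤ) (r , r′) (s , s′) →
    GcdSystem J M L N (M - i) (- r) (- r′) (- s) (- s′) × k ≡ (- r) * M
  rows⇒gcd-d {r} {r′} {s} {s′} (mr , mr′ , js , js′) =
    (balanceℤ mr′ (solve 3 (λ l m r → l :+ (con 0ℤ :- l) := m :* (:- r) :+ m :* r) refl L M r′) ,
     -- Replacing - k by M r changes the coefficient of r from - i to M - i: the equation for B is
     -- now based at C, whose image is the origin.
     balanceℤ (cong₂ _+_ js (sym mr)) (solve 7 (λ r i m n j s k →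
      (:- r) :* (m :- i) :- n :+ (n :- k :- i :* r :+ m :* r) := j :* (:- s) :+ (j :* s :+ (con 0ℤ :- k)))
      refl r i M N J s k) ,
     balanceℤ (cong₂ _+_ js′ (sym mr′)) (solve 6 (λ r i m j s l →
      (:- r) :* (m :- i) :+ (con 0ℤ :- l :- i :* r :+ m :* r) := j :* (:- s) :+ (j :* s :+ (con 0ℤ :- l)))
      refl r′ i M J s′ L)) ,
    balanceℤ mr (solve 3 (λ k m r → k :+ (con 0ℤ :- k) := (:- r) :* m :+ m :* r) refl k M r)

  gcd⇒rows-d : ∀ {a b q t} → GcdSystem J M L N (M - i) a b q t → k ≡ a * M → a * t - b * q ≡ 1ℤ →
    Rows J M i (k , L) (N , 0ℤ) (0ℤ , 0ℤ) (- a , - b) (- q , - t) × det (- a , - b) (- q , - t) ≡ 1ℤ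
  gcd⇒rows-d {a} {b} {q} {t} (l≡ , ae-n , be) k≡ det≡ =
    (balanceℤ k≡ (solve 3 (λ m a k → m :* (:- a) :+ a :* m := con 0ℤ :- k :+ k) refl M a k) ,
     balanceℤ l≡ (solve 3 (λ m b l → m :* (:- b) :+ m :* b := con 0ℤ :- l :+ l) refl M b L) ,
     balanceℤ (cong₂ _+_ ae-n k≡) (solve 7 (λ j q a i m n k →
      j :* (:- q) :+ (j :* q :+ a :* m) := n :- k :- i :* (:- a) :+ (a :* (m :- i) :- n :+ k))
      refl J q a i M N k) ,
     balanceℤ (cong₂ _+_ be l≡) (solve 6 (λ j t b i m l →
      j :* (:- t) :+ (j :* t :+ m :* b) := con 0ℤ :- l :- i :* (:- b) :+ (b :* (m :- i) :+ l))
      refl J t b i M L)) ,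
    balanceℤ det≡ (solve 4 (λ a b q t → (:- a) :* (:- t) :- (:- b) :* (:- q) :+ con 1ℤ := con 1ℤ :+ (a :* t :- b :* q)) refl a b q t)

  rows⇒gcd-e : ∀ {r r′ s s′} → Rows J M i (N , 0ℤ) (0ℤ , 0ℤ) (k , L) (r , r′) (s , s′) →
    GcdSystem J M L N i (- r) r′ s (- s′) × k ≡ N - (- r) * M
  rows⇒gcd-e {r} {r′} {s} {s′} (mr , mr′ , js , js′) =
    (balanceℤ (sym mr′) (solve 2 (λ l mr → l :+ mr := mr :+ (l :- con 0ℤ)) refl L (M * r′)) ,
     balanceℤ (sym js) (solve 4 (λ r i n js → (:- r) :* i :- n :+ js := js :+ (con 0ℤ :- n :- i :* r)) refl r i N (J * s)) ,
     balanceℤ js′ (solve 4 (λ r i j s → r :* i :+ (con 0ℤ :- con 0ℤ :- i :* r) := j :* (:- s) :+ j :* s) refl r′ i J s′)) ,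
    balanceℤ (sym mr) (solve 4 (λ k m r n → k :+ m :* r := n :- (:- r) :* m :+ (k :- n)) refl k M r N)

  gcd⇒rows-e : ∀ {a b q t} → GcdSystem J M L N i a b q t → k ≡ N - a * M → a * t - b * q ≡ 1ℤ →
    Rows J M i (N , 0ℤ) (0ℤ , 0ℤ) (k , L) (- a , b) (q , - t) × det (- a , b) (q , - t) ≡ 1ℤ
  gcd⇒rows-e {a} {b} {q} {t} (l≡ , ae-n , be) k≡ det≡ =
    (balanceℤ (sym k≡) (solve 4 (λ m a k n → m :* (:- a) :+ k := k :- n :+ (n :- a :* m)) refl M a k N) ,
     balanceℤ (sym l≡) (solve 3 (λ m b l → m :* b :+ l := l :- con 0ℤ :+ m :* b) refl M b L) ,
     balanceℤ (sym ae-n) (solve 4 (λ jq a e n → jq :+ (a :* e :- n) := con 0ℤ :- n :- e :* (:- a) :+ jq) refl (J * q) a i N) ,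
     balanceℤ be (solve 4 (λ j t b e → j :* (:- t) :+ j :* t := con 0ℤ :- con 0ℤ :- e :* b :+ b :* e) refl J t b i)) ,
    balanceℤ det≡ (solve 4 (λ a b q t → (:- a) :* (:- t) :- b :* q :+ con 1ℤ := con 1ℤ :+ (a :* t :- b :* q)) refl a b q t)

  rows⇒gcd-f : ∀ {r r′ s s′} → Rows J M i (k , L) (0ℤ , 0ℤ) (N , 0ℤ) (r , r′) (s , s′) →
    GcdSystem J M L N (M - i) r (- r′) s (- s′) × k ≡ N - r * M
  rows⇒gcd-f {r} {r′} {s} {s′} (mr , mr′ , js , js′) =
    (balanceℤ mr′ (solve 3 (λ l m r → l :+ (con 0ℤ :- l) := m :* (:- r) :+ m :* r) refl L M r′) ,
     balanceℤ (cong₂ _+_ (sym js) mr) (solve 6 (λ r i m n js k →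
      r :* (m :- i) :- n :+ (js :+ (n :- k)) := js :+ (con 0ℤ :- k :- i :* r :+ m :* r))
      refl r i M N (J * s) k) ,
     balanceℤ (cong₂ _+_ js′ (sym mr′)) (solve 6 (λ r i m j s l →
      (:- r) :* (m :- i) :+ (con 0ℤ :- l :- i :* r :+ m :* r) := j :* (:- s) :+ (j :* s :+ (con 0ℤ :- l)))
      refl r′ i M J s′ L)) ,
    balanceℤ mr (solve 4 (λ k m r n → k :+ (n :- k) := n :- r :* m :+ m :* r) refl k M r N)

  gcd⇒rows-f : ∀ {a b q t} → GcdSystem J M L N (M - i) a b q t → k ≡ N - a * M → a * t - b * q ≡ 1ℤ →
    Rows J M i (k , L) (0ℤ , 0ℤ) (N , 0ℤ) (a , - b) (q , - t) × det (a , - b) (q , - t) ≡ -1ℤ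
  gcd⇒rows-f {a} {b} {q} {t} (l≡ , ae-n , be) k≡ det≡ =
    (balanceℤ k≡ (solve 4 (λ m a k n → m :* a :+ (n :- a :* m) := n :- k :+ k) refl M a k N) ,
     balanceℤ l≡ (solve 3 (λ m b l → m :* (:- b) :+ m :* b := con 0ℤ :- l :+ l) refl M b L) ,
     balanceℤ (cong₂ _+_ (sym ae-n) k≡) (solve 6 (λ jq a i m n k →
      jq :+ (a :* (m :- i) :- n :+ (n :- a :* m)) := con 0ℤ :- k :- i :* a :+ (jq :+ k))
      refl (J * q) a i M N k) ,
     balanceℤ (cong₂ _+_ be l≡) (solve 6 (λ j t b i m l →
      j :* (:- t) :+ (j :* t :+ m :* b) := con 0ℤ :- l :- i :* (:- b) :+ (b :* (m :- i) :+ l))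
      refl J t b i M L)) ,
    balanceℤ (sym det≡) (solve 4 (λ a b q t → a :* (:- t) :- (:- b) :* q :+ (a :* t :- b :* q) := con -1ℤ :+ con 1ℤ) refl a b q t)

-- The six criteria.

module Criteria (i k : ℤ) (j m l n : ℕ)
    .{{_ : ℕ.NonZero j}} .{{_ : ℕ.NonZero m}} .{{_ : ℕ.NonZero l}} .{{_ : ℕ.NonZero n}}
    (odd-j : Odd j) (odd-m : Odd m) (mj≡nl : m ℕ.* j ≡ n ℕ.* l)
    (ι : VertexBijection (hat i j m) (hat k l n)) where

  private
    T  = hat i j m
    T′ = hat k l n
    A′ = image T T′ ι 0F
    B′ = image T T′ ι 1F
    C′ = image T T′ ι 2F
    ABC→XYZ = ABC→ T T′ ι
    ι-isIso = IsIsomorphism T T′ ι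

    point : ℤ × ℤ → Point
    point (x , y) = fromℤ x , fromℤ y

  linear : ∀ P Q R → A′ ≡ point P → B′ ≡ point Q → C′ ≡ point R → ι-isIso →
    ∃₂ λ r s → Rows (+ j) (+ m) i P Q R r s
  linear (x , x′) (y , y′) (z , z′) a b c iso =
    let r  , s  , mr  , js  = linear-coordinate i j m odd-j odd-m T′ ι proj₁ (λ _ _ → refl) proj₁ iso
                                {x} {y} {z} (cong proj₁ a) (cong proj₁ b) (cong proj₁ c)
        r′ , s′ , mr′ , js′ = linear-coordinate i j m odd-j odd-m T′ ι proj₂ (λ _ _ → refl) proj₂ iso
                                {x′} {y′} {z′} (cong proj₂ a) (cong proj₂ b) (cong proj₂ c)
    in (r , r′) , (s , s′) , mr , mr′ , js , js′

  matrix : ∀ P Q R → A′ ≡ point P → B′ ≡ point Q → C′ ≡ point R → ∀ r s δ →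
    Rows (+ j) (+ m) i P Q R r s → det r s ≡ δ → δ * δ ≡ 1ℤ → ι-isIso
  matrix (x , x′) (y , y′) (z , z′) a b c (r , r′) (s , s′) δ (mr , mr′ , js , js′) =
    matrix-isomorphism i j m T′ ι {x} {x′} {y} {y′} {z} {z′} a b c r r′ s s′ δ mr mr′ js js′

  *-cancel-m : ∀ {r z} → + m * r ≡ + m * z → r ≡ z
  *-cancel-m {r} {z} = ℤₚ.*-cancelˡ-≡ (+ m) r z

  -- If the image of the base is horizontal, the second entry of the first row vanishes, and the
  -- height l is j times the second entry of the other row.
  horizontal-base : ∀ {r′ s′} → + m * r′ ≡ 0ℤ - 0ℤ → + j * s′ ≡ + l - 0ℤ - i * r′ → j ℕ.∣ l
  horizontal-base {r′} {s′} mr′ js′ = divides-ℕ j {r = s′}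
    (height {i} {0ℤ} {+ j} {0ℤ} {+ l} {0ℤ} {r′} {s′} (*-cancel-m (trans mr′ (sym (ℤₚ.*-zeroʳ (+ m))))) js′)

  criterion-a : ABC→XYZ A′ B′ C′ → ι-isIso ⇔ (l ≡ j × n ≡ m × ∃ λ p → k ≡ i + + j * p)
  criterion-a (a , b , c) = mk⇔ necessary sufficient
    where
    necessary : ι-isIso → l ≡ j × n ≡ m × ∃ λ p → k ≡ i + + j * p
    necessary = conclude ∘ linear (0ℤ , 0ℤ) (k , + l) (+ n , 0ℤ) a b c
      where
      conclude : ∃₂ (Rows (+ j) (+ m) i (0ℤ , 0ℤ) (k , + l) (+ n , 0ℤ)) → l ≡ j × n ≡ m × ∃ λ p → k ≡ i + + j * p
      -- The integer p is the shear coefficient, the first entry of the second row.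
      conclude ((r , r′) , (s , s′) , mr , mr′ , js , js′) = proj₁ l≡j×n≡m , n≡m , s ,
        abscissa-a {i} {k} {+ j} {0ℤ} {0ℤ} {0ℤ} {r} {s} r≡1 js
        where
        mr≡n : + m * r ≡ + n
        mr≡n = trans mr (ℤₚ.+-identityʳ (+ n))
        l≡j×n≡m = squeeze (divides-ℕ m {r = r} mr≡n) (horizontal-base {r′} {s′} mr′ js′) mj≡nl
        n≡m = proj₂ l≡j×n≡m
        r≡1 : r ≡ 1ℤ
        r≡1 = *-cancel-m (trans mr≡n (trans (cong +_ n≡m) (sym (ℤₚ.*-identityʳ (+ m)))))

    sufficient : (l ≡ j × n ≡ m × ∃ λ p → k ≡ i + + j * p) → ι-isIso
    sufficient (l≡j , n≡m , p , k≡) =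
      matrix (0ℤ , 0ℤ) (k , + l) (+ n , 0ℤ) a b c (1ℤ , 0ℤ) (p , 1ℤ) 1ℤ
        (rows-a {i} {k} {+ j} {+ m} {+ l} {+ n} {p} (cong +_ l≡j) (cong +_ n≡m) k≡) refl refl

  criterion-b : ABC→XYZ C′ B′ A′ → ι-isIso ⇔ (l ≡ j × n ≡ m × ∃ λ p → k ≡ + m - i + + j * p)
  criterion-b (c , b , a) = mk⇔ necessary sufficient
    where
    necessary : ι-isIso → l ≡ j × n ≡ m × ∃ λ p → k ≡ + m - i + + j * p
    necessary = conclude ∘ linear (+ n , 0ℤ) (k , + l) (0ℤ , 0ℤ) a b c
      where
      conclude : ∃₂ (Rows (+ j) (+ m) i (+ n , 0ℤ) (k , + l) (0ℤ , 0ℤ)) → l ≡ j × n ≡ m × ∃ λ p → k ≡ + m - i + + j * p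
      conclude ((r , r′) , (s , s′) , mr , mr′ , js , js′) = proj₁ l≡j×n≡m , n≡m , s ,
        abscissa-b {i} {k} {+ j} {+ m} {0ℤ} {+ n} {r} {s} (cong +_ n≡m) r≡-1 js
        where
        -- The base is reversed, so it is - r that must equal 1.
        m[-r]≡n : + m * (- r) ≡ + n
        m[-r]≡n = begin
          + m * (- r)    ≡⟨ ℤₚ.neg-distribʳ-* (+ m) r ⟨
          - (+ m * r)    ≡⟨ cong -_ (trans mr (ℤₚ.+-identityˡ (- (+ n)))) ⟩
          - (- (+ n))    ≡⟨ ℤₚ.neg-involutive (+ n) ⟩
          + n            ∎
          where open ≡-Reasoning
        l≡j×n≡m = squeeze (divides-ℕ m {r = - r} m[-r]≡n) (horizontal-base {r′} {s′} mr′ js′) mj≡nl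
        n≡m = proj₂ l≡j×n≡m
        r≡-1 : r ≡ -1ℤ
        r≡-1 = trans (sym (ℤₚ.neg-involutive r)) (cong -_
          (*-cancel-m {z = 1ℤ} (trans m[-r]≡n (trans (cong +_ n≡m) (sym (ℤₚ.*-identityʳ (+ m)))))))

    sufficient : (l ≡ j × n ≡ m × ∃ λ p → k ≡ + m - i + + j * p) → ι-isIso
    sufficient (l≡j , n≡m , p , k≡) =
      matrix (+ n , 0ℤ) (k , + l) (0ℤ , 0ℤ) a b c (-1ℤ , 0ℤ) (p , 1ℤ) -1ℤ
        (rows-b {i} {k} {+ j} {+ m} {+ l} {+ n} {p} (cong +_ l≡j) (cong +_ n≡m) k≡) refl refl

  GcdCriterion : ℤ → (ℤ → ℤ) → Set
  GcdCriterion e κ = + n ≡ gcd e (+ j) × fromℕ l ≡ + (m ℕ.* j) / n × ∃ λ a → + j ∣ a * e - + n × k ≡ κ a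

  private
    gcd-criterion : ∀ e κ a b q t → GcdSystem (+ j) (+ m) (+ l) (+ n) e a b q t × k ≡ κ a →
      GcdCriterion e κ
    gcd-criterion e κ a b q t ((l≡ , ae-n , be) , k≡) =
      let n≡gcd , l≡mj/n , j∣ = gcd-necessary mj≡nl {e} {a} {b} {q} {t} l≡ ae-n be
      in n≡gcd , l≡mj/n , a , j∣ , k≡

  criterion-c : ABC→XYZ A′ C′ B′ → ι-isIso ⇔ GcdCriterion i (λ a → a * + m)
  criterion-c (a , c , b) = mk⇔ necessary sufficient
    where
    necessary : ι-isIso → GcdCriterion i (λ a → a * + m)
    necessary iso = let (r , r′) , (s , s′) , rows = linear (0ℤ , 0ℤ) (+ n , 0ℤ) (k , + l) a b c iso in
      gcd-criterion i (λ a → a * + m) r r′ (- s) (- s′)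
      (rows⇒gcd-c {i} {k} {+ j} {+ m} {+ l} {+ n} {r} {r′} {s} {s′} rows)

    sufficient : GcdCriterion i (λ a → a * + m) → ι-isIso
    sufficient (n≡gcd , _ , α , j∣ , k≡) =
      let β , q , t , l≡ , αe-n , βe , det≡1 = gcd-sufficient mj≡nl {i} {α} n≡gcd j∣
          rows , det≡ = gcd⇒rows-c {i} {k} {+ j} {+ m} {+ l} {+ n} {α} {β} {q} {t} (l≡ , αe-n , βe) k≡ det≡1
      in matrix (0ℤ , 0ℤ) (+ n , 0ℤ) (k , + l) a b c (α , β) (- q , - t) -1ℤ
           rows det≡ refl

  criterion-d : ABC→XYZ C′ A′ B′ → ι-isIso ⇔ GcdCriterion (+ m - i) (λ a → a * + m)
  criterion-d (c , a , b) = mk⇔ necessary sufficient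
    where
    necessary : ι-isIso → GcdCriterion (+ m - i) (λ a → a * + m)
    necessary iso = let (r , r′) , (s , s′) , rows = linear (k , + l) (+ n , 0ℤ) (0ℤ , 0ℤ) a b c iso in
      gcd-criterion (+ m - i) (λ a → a * + m) (- r) (- r′) (- s) (- s′)
      (rows⇒gcd-d {i} {k} {+ j} {+ m} {+ l} {+ n} {r} {r′} {s} {s′} rows)

    sufficient : GcdCriterion (+ m - i) (λ a → a * + m) → ι-isIso
    sufficient (n≡gcd , _ , α , j∣ , k≡) =
      let β , q , t , l≡ , αe-n , βe , det≡1 = gcd-sufficient mj≡nl {+ m - i} {α} n≡gcd j∣
          rows , det≡ = gcd⇒rows-d {i} {k} {+ j} {+ m} {+ l} {+ n} {α} {β} {q} {t} (l≡ , αe-n , βe) k≡ det≡1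
      in matrix (k , + l) (+ n , 0ℤ) (0ℤ , 0ℤ) a b c (- α , - β) (- q , - t) 1ℤ
           rows det≡ refl

  criterion-e : ABC→XYZ B′ C′ A′ → ι-isIso ⇔ GcdCriterion i (λ a → + n - a * + m)
  criterion-e (b , c , a) = mk⇔ necessary sufficient
    where
    necessary : ι-isIso → GcdCriterion i (λ a → + n - a * + m)
    necessary iso = let (r , r′) , (s , s′) , rows = linear (+ n , 0ℤ) (0ℤ , 0ℤ) (k , + l) a b c iso in
      gcd-criterion i (λ a → + n - a * + m) (- r) r′ s (- s′)
      (rows⇒gcd-e {i} {k} {+ j} {+ m} {+ l} {+ n} {r} {r′} {s} {s′} rows)

    sufficient : GcdCriterion i (λ a → + n - a * + m) → ι-isIso
    sufficient (n≡gcd , _ , α , j∣ , k≡) =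
      let β , q , t , l≡ , αe-n , βe , det≡1 = gcd-sufficient mj≡nl {i} {α} n≡gcd j∣
          rows , det≡ = gcd⇒rows-e {i} {k} {+ j} {+ m} {+ l} {+ n} {α} {β} {q} {t} (l≡ , αe-n , βe) k≡ det≡1
      in matrix (+ n , 0ℤ) (0ℤ , 0ℤ) (k , + l) a b c (- α , β) (q , - t) 1ℤ
           rows det≡ refl

  criterion-f : ABC→XYZ B′ A′ C′ → ι-isIso ⇔ GcdCriterion (+ m - i) (λ a → + n - a * + m)
  criterion-f (b , a , c) = mk⇔ necessary sufficient
    where
    necessary : ι-isIso → GcdCriterion (+ m - i) (λ a → + n - a * + m)
    necessary iso = let (r , r′) , (s , s′) , rows = linear (k , + l) (0ℤ , 0ℤ) (+ n , 0ℤ) a b c iso in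
      gcd-criterion (+ m - i) (λ a → + n - a * + m) r (- r′) s (- s′)
      (rows⇒gcd-f {i} {k} {+ j} {+ m} {+ l} {+ n} {r} {r′} {s} {s′} rows)

    sufficient : GcdCriterion (+ m - i) (λ a → + n - a * + m) → ι-isIso
    sufficient (n≡gcd , _ , α , j∣ , k≡) =
      let β , q , t , l≡ , αe-n , βe , det≡1 = gcd-sufficient mj≡nl {+ m - i} {α} n≡gcd j∣
          rows , det≡ = gcd⇒rows-f {i} {k} {+ j} {+ m} {+ l} {+ n} {α} {β} {q} {t} (l≡ , αe-n , βe) k≡ det≡1
      in matrix (k , + l) (0ℤ , 0ℤ) (+ n , 0ℤ) a b c (α , - β) (q , - t) -1ℤ
           rows det≡ refl

theorem6p3 : (i k : ℤ) (j m l n : ℕ)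
    .{{_ : ℕ.NonZero j}} .{{_ : ℕ.NonZero m}} .{{_ : ℕ.NonZero l}} .{{_ : ℕ.NonZero n}} →
    Odd j → Odd m → Odd l → Odd n →
    let T  = hat i j m
        T′ = hat k l n
    in
    EqualBoundaryTypes T T′ ⊎ OppositeBoundaryTypes T T′ →
    area T ≡ area T′ →
    (ι : VertexBijection T T′) →
    let A′ = image T T′ ι 0F
        B′ = image T T′ ι 1F
        C′ = image T T′ ι 2F
        ABC→XYZ = ABC→ T T′ ι
        ι-isIso = IsIsomorphism T T′ ι
    in
    (ABC→XYZ A′ B′ C′ ⊎ ABC→XYZ C′ B′ A′ ⊎ ABC→XYZ A′ C′ B′ ⊎
     ABC→XYZ C′ A′ B′ ⊎ ABC→XYZ B′ C′ A′ ⊎ ABC→XYZ B′ A′ C′)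
    × (ABC→XYZ A′ B′ C′ → ι-isIso ⇔
        (l ≡ j × n ≡ m × ∃ λ p → k ≡ i + + j * p))
    × (ABC→XYZ C′ B′ A′ → ι-isIso ⇔
        (l ≡ j × n ≡ m × ∃ λ p → k ≡ + m - i + + j * p))
    × (ABC→XYZ A′ C′ B′ → ι-isIso ⇔
        (+ n ≡ gcd i (+ j) × fromℕ l ≡ + (m ℕ.* j) / n ×
         ∃ λ a → + j ∣ a * i - + n × k ≡ a * + m))
    × (ABC→XYZ C′ A′ B′ → ι-isIso ⇔
        (+ n ≡ gcd (+ m - i) (+ j) × fromℕ l ≡ + (m ℕ.* j) / n ×
         ∃ λ a → + j ∣ a * (+ m - i) - + n × k ≡ a * + m))
    × (ABC→XYZ B′ C′ A′ → ι-isIso ⇔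
        (+ n ≡ gcd i (+ j) × fromℕ l ≡ + (m ℕ.* j) / n ×
         ∃ λ a → + j ∣ a * i - + n × k ≡ + n - a * + m))
    × (ABC→XYZ B′ A′ C′ → ι-isIso ⇔
        (+ n ≡ gcd (+ m - i) (+ j) × fromℕ l ≡ + (m ℕ.* j) / n ×
         ∃ λ a → + j ∣ a * (+ m - i) - + n × k ≡ + n - a * + m))
theorem6p3 i k j m l n odd-j odd-m _ _ _ area≡ ι =
  six-kinds (hat i j m) (hat k l n) ι ,
  criterion-a , criterion-b , criterion-c , criterion-d , criterion-e , criterion-f
  where open Criteria i k j m l n odd-j odd-m (equal-area i j m k l n area≡) ι
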